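{- $\lambda_3(n)\ge 2n\,\alpha(n)-O(n)$ for all $n$.
   Context: A Davenport--Schinzel sequence of order $s$ is a finite sequence with no two adjacent equal entries and containing no (not necessarily contiguous) subsequence $a\,b\,a\,b\ldots$ of length $s+2$ with $a\ne b$. $\lambda_s(n)$ is the maximum length of such a sequence on $n$ distinct symbols. The inverse Ackermann hierarchy: $\alpha_1(x)=\lceil x/2\rceil$; for $k\ge2$, $\alpha_k(x)=0$ if $x\le1$ and $\alpha_k(x)=1+\alpha_k(\alpha_{k-1}(x))$ otherwise. The inverse Ackermann function is $\alpha(x)=\min\{k\mid\alpha_k(x)\le3\}$. -}

module Defs where

open import Data.Nat using (ℕ; zero; suc; _+_; _≤_; _<_; ⌈_/2⌉)
open import Data.List using (List; []; _∷_)
open import Data.List.Relation.Unary.Linked using (Linked)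
open import Data.List.Relation.Binary.Sublist.Propositional using (_⊆_)
open import Data.Product using (_×_)
open import Relation.Binary.PropositionalEquality using (_≡_; _≢_)
open import Relation.Nullary using (¬_)

alt : {A : Set} → A → A → ℕ → List A
alt a b zero    = []
alt a b (suc m) = a ∷ alt b a m

DS : {A : Set} → ℕ → List A → Set
DS {A} s w = Linked (λ x y → x ≢ y) w
           × (∀ (a b : A) → a ≢ b → ¬ (alt a b (s + 2) ⊆ w))

-- iteration for α_k, k ≥ 2:  α_k(x) = 0 if x ≤ 1, else 1 + α_k(α_{k-1}(x)).
-- Fuel x suffices, since α_{k-1}(x) < x for x ≥ 2.
iterA : (ℕ → ℕ) → ℕ → ℕ → ℕ
iterA f zero          x             = 0
iterA f (suc fuel)    zero          = 0
iterA f (suc fuel)    (suc zero)    = 0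
iterA f (suc fuel)    (suc (suc y)) = suc (iterA f fuel (f (suc (suc y))))

-- αh k x = α_k(x) for k ≥ 1 (αh 0 is an unused junk value)
αh : ℕ → ℕ → ℕ
αh zero          x = ⌈ x /2⌉
αh (suc zero)    x = ⌈ x /2⌉
αh (suc (suc k)) x = iterA (αh (suc k)) x x

IsInvAck : ℕ → ℕ → Set
IsInvAck x k = 1 ≤ k × αh k x ≤ 3 × (∀ j → 1 ≤ j → j < k → ¬ (αh j x ≤ 3))

{-# OPTIONS --safe #-}
-- A block (F , L) inside a sequence lists symbols F that have not occurred before and
-- symbols L that will not occur again. Take a sequence Z* whose g blocks hold f symbols
-- of each kind, and g disjoint copies of a sequence Z whose f blocks hold m symbols of
-- each kind. Replace the t-th block (F , L) of Z* by the t-th copy of Z, and in that copy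
-- turn the j-th block, read F′ L′, into  c F′ a c L′ a  with a = F j and c = L j. The one
-- occurrence of a in F becomes two, and so does the one of c in L, so every symbol of Z*
-- gains two occurrences; and a joins F′ while c joins L′, so the new blocks hold m + 1
-- symbols of each kind. No alternation a b a b a arises: for any two symbols the new
-- sequence splits into four segments each of which misses one of them.
-- Iterating with Z = Z d m and Z* = Z (d ∸ 1) f gives sequences Z d (m + 1) whose symbols
-- occur about 2 d times on average, while the number of blocks grows like the Ackermann
-- hierarchy that αh inverts. A chain of such copies has length 2 n d ∸ O(n) on n symbols.
module Submission where

open import Defs
open import Data.Nat using (ℕ; zero; suc; _+_; _*_; _^_; _∸_; _≤_; _<_; z≤n; s≤s; ⌈_/2⌉; NonZero; >-nonZero)
import Data.Nat.Properties as ℕ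
open import Data.Nat.DivMod using (_/_; _%_)
import Data.Nat.DivMod as ℕ
open import Data.Nat.Tactic.RingSolver using (solve-∀)
open import Data.Fin using (Fin; zero; suc; _↑ˡ_; _↑ʳ_; combine; inject≤; splitAt)
import Data.Fin.Properties as Fin
open import Data.List using (List; []; _∷_; [_]; _++_; length)
import Data.List as List
import Data.List.Properties as List
open import Data.List.Membership.Propositional using (_∈_)
open import Data.List.Membership.Propositional.Properties using (∈-++⁻; ∈-map⁻)
import Data.List.Membership.DecPropositional as DecMembership
open import Data.List.Relation.Unary.Any using (here; there)
open import Data.List.Relation.Unary.All as All using (All; []; _∷_)
import Data.List.Relation.Unary.All.Properties as All
open import Data.List.Relation.Unary.AllPairs using ([]; _∷_)
open import Data.List.Relation.Unary.Linked using (Linked; []; [-]; _∷_)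
open import Data.List.Relation.Unary.Unique.Propositional using (Unique)
import Data.List.Relation.Unary.Unique.Propositional.Properties as Unique
open import Data.List.Relation.Binary.Sublist.Propositional using (_⊆_; []; _∷_; _∷ʳ_)
open import Data.Vec as Vec using (Vec; []; _∷_; lookup; toList)
import Data.Vec.Properties as Vec
open import Data.Product using (Σ; ∃; _×_; _,_; proj₁; proj₂)
open import Data.Product.Properties as Product using (,-injectiveˡ; ,-injectiveʳ)
open import Data.Sum as Sum using (_⊎_; inj₁; inj₂; swap)
open import Data.Sum.Properties as Sum using (inj₁-injective; inj₂-injective)
open import Data.Empty using (⊥; ⊥-elim)
open import Data.Unit using (⊤; tt)
open import Function using (_∘_; id)
open import Relation.Binary.Definitions using (DecidableEquality)
open import Relation.Binary.PropositionalEquality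
  using (_≡_; _≢_; refl; sym; trans; cong; cong₂; subst; ≢-sym; module ≡-Reasoning)
open import Relation.Nullary using (¬_; Dec; yes; no)
open import Relation.Nullary.Decidable using (_×-dec_; _⊎-dec_)

private
  variable
    A B C : Set
    f g k m : ℕ
    x y z : A
    u v w : List A

-- Alternations as segments

infix 4 _∌_

_∌_ : List A → A → Set
w ∌ x = All (_≢ x) w

∉⇒∌ : ¬ (x ∈ w) → w ∌ x
∉⇒∌ p = All.map ≢-sym (All.¬Any⇒All¬ _ p)

∈⇒∌ : (∀ {z} → z ∈ w → z ≢ x) → w ∌ x
∈⇒∌ p = All.tabulate p

∌-map : {h : A → B} (w : List A) → (∀ z → h z ≢ x) → List.map h w ∌ x
∌-map w p = All.map⁺ (All.universal p w)

∌-map-injective : {h : A → B} → (∀ {a b} → h a ≡ h b → a ≡ b) → w ∌ x → List.map h w ∌ h x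
∌-map-injective inj p = All.map⁺ (All.map (λ z≢x → z≢x ∘ inj) p)

-- Runs x y k w: w is a concatenation of k + 1 (possibly empty) segments
-- which alternately miss y and x, the first one missing y.
data Runs {A : Set} : A → A → ℕ → List A → Set where
  stop : Runs x y k []
  step : z ≢ y → Runs x y k w → Runs x y k (z ∷ w)
  turn : Runs y x k w → Runs x y (suc k) w

cover : u ∌ y → Runs x y k w → Runs x y k (u ++ w)
cover []       r = r
cover (p ∷ ps) r = step p (cover ps r)

missing : w ∌ y → Runs x y k w
missing {w = w} p = subst (Runs _ _ _) (List.++-identityʳ w) (cover p stop)

relax : Runs x y k w → Runs x y (suc k) w
relax stop       = stop
relax (step p r) = step p (relax r)
relax (turn r)   = turn (relax r)

-- A segment misses `x` or `y`, so an alternation takes at most one letter from it, and one that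
-- starts with `y` takes none from the first segment. The two bounds are proved together because a
-- matched letter and a `turn` both exchange the roles of `x` and `y`.
alt-bound : Runs x y k w →
  (∀ n → alt x y n ⊆ w → n ≤ suc k) × (∀ n → alt y x n ⊆ w → n ≤ k)
alt-bound {x = x} {y = y} {k = k} stop = first , second
  where
  first : ∀ n → alt x y n ⊆ [] → n ≤ suc k
  first zero _ = z≤n
  second : ∀ n → alt y x n ⊆ [] → n ≤ k
  second zero _ = z≤n
alt-bound {x = x} {y = y} {k = k} (step {z = z} {w = w} z≢y r) = first , second
  where
  first : ∀ n → alt x y n ⊆ z ∷ w → n ≤ suc k
  first zero    _        = z≤n
  first (suc n) (_ ∷ʳ p) = proj₁ (alt-bound r) (suc n) p
  first (suc n) (_ ∷ p)  = s≤s (proj₂ (alt-bound r) n p)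
  second : ∀ n → alt y x n ⊆ z ∷ w → n ≤ k
  second zero    _          = z≤n
  second (suc n) (_ ∷ʳ p)   = proj₂ (alt-bound r) (suc n) p
  second (suc n) (refl ∷ _) = ⊥-elim (z≢y refl)
alt-bound (turn r) =
  (λ n p → ℕ.m≤n⇒m≤1+n (ℕ.m≤n⇒m≤1+n (proj₂ (alt-bound r) n p))) , proj₁ (alt-bound r)

-- The index 3 stands for four segments, which leave room for at most four alternating letters.
-- Either symbol may be the one missing first, so the notion is symmetric.
FourRuns : A → A → List A → Set
FourRuns x y w = Runs x y 3 w ⊎ Runs y x 3 w

fourRuns⇒¬alt : FourRuns x y w → ¬ (alt x y 5 ⊆ w)
fourRuns⇒¬alt (inj₁ r) p = ℕ.<-irrefl refl (proj₁ (alt-bound r) 5 p)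
fourRuns⇒¬alt (inj₂ r) p = ℕ.<-irrefl refl (ℕ.m≤n⇒m≤1+n (proj₂ (alt-bound r) 5 p))

-- Traces h I u v: v arises from h(u) by stuttering and deleting letters, and by
-- inserting letters satisfying I.
data Traces {A B : Set} (h : A → B) (I : B → Set) : List A → List B → Set where
  nil     : Traces h I [] []
  keep    : Traces h I u v → Traces h I (z ∷ u) (h z ∷ v)
  stutter : Traces h I (z ∷ u) v → Traces h I (z ∷ u) (h z ∷ v)
  insert  : {z : B} → I z → Traces h I u v → Traces h I u (z ∷ v)
  delete  : Traces h I u v → Traces h I (z ∷ u) v

module _ {h : A → B} {I : B → Set} where

  insert-all : All I w → Traces h I u v → Traces h I u (w ++ v)
  insert-all []       t = t
  insert-all (p ∷ ps) t = insert p (insert-all ps t)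

  keep-all : ∀ w → Traces h I u v → Traces h I (w ++ u) (List.map h w ++ v)
  keep-all []      t = t
  keep-all (_ ∷ w) t = keep (keep-all w t)

  delete-all : ∀ w → Traces h I u v → Traces h I (w ++ u) v
  delete-all []      t = t
  delete-all (_ ∷ w) t = delete (delete-all w t)

  traces-++ : ∀ {u u′ v v′} →
    Traces h I u v → Traces h I u′ v′ → Traces h I (u ++ u′) (v ++ v′)
  traces-++ nil          t = t
  traces-++ (keep s)     t = keep (traces-++ s t)
  traces-++ (stutter s)  t = stutter (traces-++ s t)
  traces-++ (insert p s) t = insert p (traces-++ s t)
  traces-++ (delete s)   t = delete (traces-++ s t)

  traces-∌ : (∀ {a b} → h a ≡ h b → a ≡ b) → (∀ {z} → I z → z ≢ h x) →
    Traces h I u v → u ∌ x → v ∌ h x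
  traces-∌ inj p nil          []       = []
  traces-∌ inj p (keep t)     (q ∷ qs) = q ∘ inj ∷ traces-∌ inj p t qs
  traces-∌ inj p (stutter t)  (q ∷ qs) = q ∘ inj ∷ traces-∌ inj p t (q ∷ qs)
  traces-∌ inj p (insert i t) qs       = p i ∷ traces-∌ inj p t qs
  traces-∌ inj p (delete t)   (q ∷ qs) = traces-∌ inj p t qs

  -- The cuts carry over: a kept or stuttered letter stays in the segment of its origin, and an
  -- inserted letter, being neither `h x` nor `h y`, fits into any segment.
  runs-transfer : (∀ {a b} → h a ≡ h b → a ≡ b) →
    (∀ {z} → I z → z ≢ h x) → (∀ {z} → I z → z ≢ h y) →
    Traces h I u v → Runs x y k u → Runs (h x) (h y) k v
  runs-transfer inj px py t            (turn r)     = turn (runs-transfer inj py px t r)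
  runs-transfer inj px py nil          stop         = stop
  runs-transfer inj px py (insert p t) r            = step (py p) (runs-transfer inj px py t r)
  runs-transfer inj px py (keep t)     (step z≢y r) = step (z≢y ∘ inj) (runs-transfer inj px py t r)
  runs-transfer inj px py (stutter t)  (step z≢y r) =
    step (z≢y ∘ inj) (runs-transfer inj px py t (step z≢y r))
  runs-transfer inj px py (delete t)   (step z≢y r) = runs-transfer inj px py t r

  fourRuns-transfer : (∀ {a b} → h a ≡ h b → a ≡ b) →
    (∀ {z} → I z → z ≢ h x) → (∀ {z} → I z → z ≢ h y) →
    Traces h I u v → FourRuns x y u → FourRuns (h x) (h y) v
  fourRuns-transfer inj px py t (inj₁ r) = inj₁ (runs-transfer inj px py t r)
  fourRuns-transfer inj px py t (inj₂ r) = inj₂ (runs-transfer inj py px t r)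

-- Sequences with blocks

-- blk x F L s is the symbol x followed by the block (F , L) followed by s, so that every
-- block lies between two plain symbols, which keeps adjacent symbols distinct when a
-- sequence takes the place of the block. The block itself is only such a place: word
-- omits it, while the alternations are controlled in flat, where each of its symbols
-- counts as one occurrence.
data Seq (A : Set) (m : ℕ) : ℕ → Set where
  one : A → Seq A m 0
  _◂_ : A → Seq A m f → Seq A m f
  blk : A → Vec A m → Vec A m → Seq A m f → Seq A m (suc f)

infixr 5 _◂_ _+++_

flat : Seq A m f → List A
flat (one x)       = [ x ]
flat (x ◂ s)       = x ∷ flat s
flat (blk x F L s) = x ∷ toList F ++ toList L ++ flat s

head : Seq A m f → A
head (one x)       = x
head (x ◂ s)       = x
head (blk x F L s) = x

word : Seq A m f → List A
word (one x)       = [ x ]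
word (x ◂ s)       = x ∷ word s
word (blk x F L s) = x ∷ word s

Proper : Seq A m f → Set
Proper (one x)       = ⊤
Proper (x ◂ s)       = x ≢ head s × Proper s
Proper (blk x F L s) = x ≢ head s × Proper s

_+++_ : Seq A m f → Seq A m g → Seq A m (f + g)
one x +++ t       = x ◂ t
(x ◂ s) +++ t     = x ◂ (s +++ t)
blk x F L s +++ t = blk x F L (s +++ t)

last : Seq A m f → A
last (one x)       = x
last (x ◂ s)       = last s
last (blk x F L s) = last s

head-+++ : ∀ (s : Seq A m f) (t : Seq A m g) → head (s +++ t) ≡ head s
head-+++ (one x)       t = refl
head-+++ (x ◂ s)       t = refl
head-+++ (blk x F L s) t = refl

length-+++ : ∀ (s : Seq A m f) (t : Seq A m g) →
  length (word (s +++ t)) ≡ length (word s) + length (word t)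
length-+++ (one x)       t = refl
length-+++ (x ◂ s)       t = cong suc (length-+++ s t)
length-+++ (blk x F L s) t = cong suc (length-+++ s t)

proper-+++ : ∀ (s : Seq A m f) (t : Seq A m g) →
  Proper s → last s ≢ head t → Proper t → Proper (s +++ t)
proper-+++ (one x)       t _        x≢ q = x≢ , q
proper-+++ (x ◂ s)       t (x≢ , p) y≢ q = subst (x ≢_) (sym (head-+++ s t)) x≢ , proper-+++ s t p y≢ q
proper-+++ (blk x F L s) t (x≢ , p) y≢ q = subst (x ≢_) (sym (head-+++ s t)) x≢ , proper-+++ s t p y≢ q

record Block (A : Set) (m : ℕ) : Set where
  constructor block
  field
    before : List A
    firsts : Vec A m
    lasts  : Vec A m
    after  : List A
open Block

prepend : List A → Block A m → Block A m
prepend u b = record b { before = u ++ before b }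

append : Block A m → List A → Block A m
append b v = record b { after = after b ++ v }

at : Seq A m f → Fin f → Block A m
at (x ◂ s)       j       = prepend [ x ] (at s j)
at (blk x F L s) zero    = block [ x ] F L (flat s)
at (blk x F L s) (suc j) = prepend (x ∷ toList F ++ toList L) (at s j)

flat-at : ∀ (s : Seq A m f) j → let b = at s j in
  flat s ≡ before b ++ toList (firsts b) ++ toList (lasts b) ++ after b
flat-at (x ◂ s)       j       = cong (x ∷_) (flat-at s j)
flat-at (blk x F L s) zero    = refl
flat-at (blk x F L s) (suc j) =
  cong (x ∷_) (trans (cong (λ w → toList F ++ toList L ++ w) (flat-at s j))
    (trans (sym (List.++-assoc (toList F) (toList L) _))
      (sym (List.++-assoc (toList F ++ toList L) (before (at s j)) _))))

prepend-++ : ∀ (u v : List A) (b : Block A m) → prepend u (prepend v b) ≡ prepend (u ++ v) b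
prepend-++ u v b = cong (λ w → record b { before = w }) (sym (List.++-assoc u v (before b)))

flat-+++ : ∀ (s : Seq A m f) (t : Seq A m g) → flat (s +++ t) ≡ flat s ++ flat t
flat-+++ (one x)       t = refl
flat-+++ (x ◂ s)       t = cong (x ∷_) (flat-+++ s t)
flat-+++ (blk x F L s) t = cong (x ∷_) (trans (cong (λ w → toList F ++ toList L ++ w) (flat-+++ s t))
  (trans (sym (cong (toList F ++_) (List.++-assoc (toList L) (flat s) (flat t))))
    (sym (List.++-assoc (toList F) _ (flat t)))))

at-↑ˡ : ∀ (s : Seq A m f) (t : Seq A m g) j → at (s +++ t) (j ↑ˡ g) ≡ append (at s j) (flat t)
at-↑ˡ (x ◂ s)       t j       rewrite at-↑ˡ s t j = refl
at-↑ˡ (blk x F L s) t zero    rewrite flat-+++ s t = refl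
at-↑ˡ (blk x F L s) t (suc j) rewrite at-↑ˡ s t j = refl

at-↑ʳ : ∀ (s : Seq A m f) (t : Seq A m g) j → at (s +++ t) (f ↑ʳ j) ≡ prepend (flat s) (at t j)
at-↑ʳ (one x)       t j = refl
at-↑ʳ (x ◂ s)       t j rewrite at-↑ʳ s t j = refl
at-↑ʳ (blk x F L s) t j rewrite at-↑ʳ s t j =
  trans (prepend-++ (x ∷ toList F ++ toList L) (flat s) (at t j))
    (cong (λ u → prepend (x ∷ u) (at t j)) (List.++-assoc (toList F) (toList L) (flat s)))

-- Newness and finality refer to `flat`, where the symbols of all other blocks count too. Uniqueness
-- and disjointness keep the pairs a = F j, c = L j of different j apart.
record Valid (b : Block A m) : Set where
  field
    first-new    : ∀ {a} → a ∈ toList (firsts b) → before b ∌ a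
    last-final   : ∀ {a} → a ∈ toList (lasts b) → after b ∌ a
    first-unique : Unique (toList (firsts b))
    last-unique  : Unique (toList (lasts b))
    disjoint     : ∀ {a c} → a ∈ toList (firsts b) → c ∈ toList (lasts b) → a ≢ c

record Good (s : Seq A m f) : Set where
  field
    four-runs : ∀ {x y} → x ≢ y → FourRuns x y (flat s)
    valid     : ∀ j → Valid (at s j)
    proper    : Proper s
open Good

lookup∈ : ∀ (F : Vec A f) j → lookup F j ∈ toList F
lookup∈ (a ∷ F) zero    = here refl
lookup∈ (a ∷ F) (suc j) = there (lookup∈ F j)

index-of : ∀ {a} (F : Vec A f) → a ∈ toList F → ∃ λ j → lookup F j ≡ a
index-of (a ∷ F) (here refl) = zero , refl
index-of (a ∷ F) (there p)   = let j , eq = index-of F p in suc j , eq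

-- Inserting the symbols of one block into a copy

module Insertion (ι : A → B) (κ : C → B) where

  -- Here `ι` embeds the symbols of Z* and `κ` those of the copy. In c F′ a c L′ a the outer c and a
  -- are plain symbols, and what lies between them is the enlarged block.
  ins : Seq C m f → Vec A f → Vec A f → Seq B (suc m) f
  ins (one x)         []      []      = one (κ x)
  ins (x ◂ s)         F       L       = κ x ◂ ins s F L
  ins (blk x F′ L′ s) (a ∷ F) (c ∷ L) =
    κ x ◂ blk (ι c) (Vec.map κ F′ Vec.∷ʳ ι a) (ι c ∷ Vec.map κ L′) (ι a ◂ ins s F L)

  toList-firsts : ∀ (F′ : Vec C m) b → toList (Vec.map κ F′ Vec.∷ʳ b) ≡ List.map κ (toList F′) ++ [ b ]
  toList-firsts F′ b = trans (Vec.toList-∷ʳ b (Vec.map κ F′)) (cong (_++ [ b ]) (Vec.toList-map κ F′))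

  core : List C → List C → A → A → List B → List B
  core F′ L′ a c w = ι c ∷ List.map κ F′ ++ ι a ∷ ι c ∷ List.map κ L′ ++ ι a ∷ w

  core-++ : ∀ F′ L′ a c v w → core F′ L′ a c v ++ w ≡ core F′ L′ a c (v ++ w)
  core-++ F′ L′ a c v w = cong (ι c ∷_) (trans (List.++-assoc (List.map κ F′) _ w)
    (cong (λ z → List.map κ F′ ++ ι a ∷ ι c ∷ z) (List.++-assoc (List.map κ L′) _ w)))

  flat-block : ∀ (F′ L′ : Vec C m) a c w →
    ι c ∷ toList (Vec.map κ F′ Vec.∷ʳ ι a) ++ toList (ι c ∷ Vec.map κ L′) ++ ι a ∷ w
      ≡ core (toList F′) (toList L′) a c w
  flat-block F′ L′ a c w rewrite toList-firsts F′ (ι a) | Vec.toList-map κ L′ =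
    cong (ι c ∷_) (List.++-assoc (List.map κ (toList F′)) _ _)

  flat-ins : ∀ x (F′ L′ : Vec C m) (s : Seq C m f) a c F L →
    flat (ins (blk x F′ L′ s) (a ∷ F) (c ∷ L)) ≡ κ x ∷ core (toList F′) (toList L′) a c (flat (ins s F L))
  flat-ins x F′ L′ s a c F L = cong (κ x ∷_) (flat-block F′ L′ a c _)

  head-ins : ∀ (s : Seq C m f) F L → head (ins s F L) ≡ κ (head s)
  head-ins (one x)         []      []      = refl
  head-ins (x ◂ s)         F       L       = refl
  head-ins (blk x F′ L′ s) (a ∷ F) (c ∷ L) = refl

  last-ins : ∀ (s : Seq C m f) F L → last (ins s F L) ≡ κ (last s)
  last-ins (one x)         []      []      = refl
  last-ins (x ◂ s)         F       L       = last-ins s F L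
  last-ins (blk x F′ L′ s) (a ∷ F) (c ∷ L) = last-ins s F L

  -- Only the plain c and a around each block count in `word`; the occurrences inside the block are
  -- mere places.
  length-ins : ∀ (s : Seq C m f) F L → length (word (ins s F L)) ≡ length (word s) + 2 * f
  length-ins (one x)         []      []      = refl
  length-ins (x ◂ s)         F       L       = cong suc (length-ins s F L)
  length-ins {f = suc f} (blk x F′ L′ s) (a ∷ F) (c ∷ L) = cong suc
    (trans (cong (2 +_) (length-ins s F L)) (trans (ℕ.+-comm 2 _)
      (trans (ℕ.+-assoc (length (word s)) (2 * f) 2)
        (cong (length (word s) +_) (trans (ℕ.+-comm (2 * f) 2) (sym (ℕ.*-suc 2 f)))))))

  module _ {I : B → Set} where

    core-All : ∀ F′ L′ {a c w} → (∀ z → I (κ z)) → I (ι a) → I (ι c) → All I w → All I (core F′ L′ a c w)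
    core-All F′ L′ p pa pc pw = pc ∷ All.++⁺ (All.map⁺ (All.universal p F′))
      (pa ∷ pc ∷ All.++⁺ (All.map⁺ (All.universal p L′)) (pa ∷ pw))

    ins-All : ∀ (s : Seq C m f) F L → (∀ z → I (κ z)) →
      All (I ∘ ι) (toList F) → All (I ∘ ι) (toList L) → All I (flat (ins s F L))
    ins-All (one x) [] [] p pF pL = p x ∷ []
    ins-All (x ◂ s) F  L  p pF pL = p x ∷ ins-All s F L p pF pL
    ins-All (blk x F′ L′ s) (a ∷ F) (c ∷ L) p (pa ∷ pF) (pc ∷ pL)
      rewrite flat-ins x F′ L′ s a c F L =
      p x ∷ core-All (toList F′) (toList L′) p pa pc (ins-All s F L p pF pL)

    -- Deleting the symbols of Z* gives back `flat s`, so two symbols of one copy alternate no more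
    -- than they do in Z.
    ins-locals : ∀ (s : Seq C m f) F L → (∀ a → I (ι a)) → Traces κ I (flat s) (flat (ins s F L))
    ins-locals (one x) [] [] p = keep nil
    ins-locals (x ◂ s) F  L  p = keep (ins-locals s F L p)
    ins-locals (blk x F′ L′ s) (a ∷ F) (c ∷ L) p rewrite flat-ins x F′ L′ s a c F L =
      keep (insert (p c) (keep-all (toList F′) (insert (p a) (insert (p c)
        (keep-all (toList L′) (insert (p a) (ins-locals s F L p)))))))

    -- For pairs of symbols that avoid `L`, the copy is `F` with every a doubled and harmless
    -- filling around it: `stutter` is the a before c L′ and `keep` the a after it.
    ins-firsts : ∀ (s : Seq C m f) F L → (∀ z → I (κ z)) → All (I ∘ ι) (toList L) →
      Traces ι I (toList F) (flat (ins s F L))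
    ins-firsts (one x) [] [] p pL = insert (p x) nil
    ins-firsts (x ◂ s) F  L  p pL = insert (p x) (ins-firsts s F L p pL)
    ins-firsts (blk x F′ L′ s) (a ∷ F) (c ∷ L) p (pc ∷ pL) rewrite flat-ins x F′ L′ s a c F L =
      insert (p x) (insert pc (insert-all (All.map⁺ (All.universal p (toList F′)))
        (stutter (insert pc (insert-all (All.map⁺ (All.universal p (toList L′)))
          (keep (ins-firsts s F L p pL)))))))

    ins-lasts : ∀ (s : Seq C m f) F L → (∀ z → I (κ z)) → All (I ∘ ι) (toList F) →
      Traces ι I (toList L) (flat (ins s F L))
    ins-lasts (one x) [] [] p pF = insert (p x) nil
    ins-lasts (x ◂ s) F  L  p pF = insert (p x) (ins-lasts s F L p pF)
    ins-lasts (blk x F′ L′ s) (a ∷ F) (c ∷ L) p (pa ∷ pF) rewrite flat-ins x F′ L′ s a c F L =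
      insert (p x) (stutter (insert-all (All.map⁺ (All.universal p (toList F′)))
        (insert pa (keep (insert-all (All.map⁺ (All.universal p (toList L′)))
          (insert pa (ins-lasts s F L p pF)))))))

  -- U and V are what precedes and what follows  c F′ a c L′ a  at the j-th block.
  record Slot (s : Seq C m f) (F L : Vec A f) (j : Fin f) : Set where
    field
      U V     : List B
      at-ins  : let b = at s j in at (ins s F L) j ≡
        block (U ++ [ ι (lookup L j) ]) (Vec.map κ (firsts b) Vec.∷ʳ ι (lookup F j))
          (ι (lookup L j) ∷ Vec.map κ (lasts b)) (ι (lookup F j) ∷ V)
      U-local : ∀ {z} → before (at s j) ∌ z → U ∌ κ z
      V-local : ∀ {z} → after (at s j) ∌ z → V ∌ κ z
      U∌first : U ∌ ι (lookup F j)
      V∌first : V ∌ ι (lookup F j)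
      U∌last  : U ∌ ι (lookup L j)
      V∌last  : V ∌ ι (lookup L j)

    flat-slot : let b = at s j in flat (ins s F L) ≡
      U ++ core (toList (firsts b)) (toList (lasts b)) (lookup F j) (lookup L j) V
    flat-slot = trans (flat-at (ins s F L) j) (trans
      (cong (λ b → before b ++ toList (firsts b) ++ toList (lasts b) ++ after b) at-ins)
      (trans (List.++-assoc U _ _) (cong (U ++_) (flat-block _ _ _ _ _))))

  module _ (ι-injective : ∀ {a b} → ι a ≡ ι b → a ≡ b) (κ-injective : ∀ {a b} → κ a ≡ κ b → a ≡ b)
    (ι≢κ : ∀ {a b} → ι a ≢ κ b) where

    -- Since `word` omits the block, c and a become adjacent, and disjointness keeps them distinct.
    -- Every other new adjacency joins a symbol of Z* to one of the copy.
    ins-proper : ∀ (s : Seq C m f) {F L} → Proper s →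
      (∀ {a c} → a ∈ toList F → c ∈ toList L → a ≢ c) → Proper (ins s F L)
    ins-proper (one x) {[]} {[]} p d = tt
    ins-proper (x ◂ s) {F} {L} (x≢ , p) d =
      subst (κ x ≢_) (sym (head-ins s F L)) (x≢ ∘ κ-injective) , ins-proper s p d
    ins-proper (blk x F′ L′ s) {a ∷ F} {c ∷ L} (x≢ , p) d =
      ≢-sym ι≢κ , ≢-sym (d (here refl) (here refl)) ∘ ι-injective ,
      subst (ι a ≢_) (sym (head-ins s F L)) ι≢κ , ins-proper s p (λ q r → d (there q) (there r))

    ins-∌ : ∀ (s : Seq C m f) {F L a} → toList F ∌ a → toList L ∌ a → flat (ins s F L) ∌ ι a
    ins-∌ s p q = ins-All s _ _ (λ _ → ≢-sym ι≢κ) (All.map (_∘ ι-injective) p) (All.map (_∘ ι-injective) q)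

    ins-local-∌ : ∀ (s : Seq C m f) {F L z} → flat s ∌ z → flat (ins s F L) ∌ κ z
    ins-local-∌ s = traces-∌ κ-injective id (ins-locals s _ _ (λ _ → ι≢κ))

    -- The other slots contain neither a nor c: a repetition within `F` or within `L` is excluded by
    -- uniqueness, one across the two by disjointness.
    slot : ∀ (s : Seq C m f) F L j → Unique (toList F) → Unique (toList L) →
      (∀ {a c} → a ∈ toList F → c ∈ toList L → a ≢ c) → Slot s F L j
    slot (x ◂ s) F L j uF uL d = record
      { U = κ x ∷ U; V = V; at-ins = cong (prepend [ κ x ]) at-ins
      ; U-local = λ { (p ∷ ps) → p ∘ κ-injective ∷ U-local ps } ; V-local = V-local
      ; U∌first = ≢-sym ι≢κ ∷ U∌first ; V∌first = V∌first
      ; U∌last = ≢-sym ι≢κ ∷ U∌last ; V∌last = V∌last }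
      where open Slot (slot s F L j uF uL d)
    slot (blk x F′ L′ s) (a ∷ F) (c ∷ L) zero (a∉F ∷ _) (c∉L ∷ _) d = record
      { U = [ κ x ] ; V = flat (ins s F L) ; at-ins = refl
      ; U-local = λ { (p ∷ []) → p ∘ κ-injective ∷ [] } ; V-local = ins-local-∌ s
      ; U∌first = ≢-sym ι≢κ ∷ []
      ; V∌first = ins-∌ s (All.map ≢-sym a∉F) (∈⇒∌ (λ z∈L → ≢-sym (d (here refl) (there z∈L))))
      ; U∌last = ≢-sym ι≢κ ∷ []
      ; V∌last = ins-∌ s (∈⇒∌ (λ z∈F → d (there z∈F) (here refl))) (All.map ≢-sym c∉L) }
    slot (blk x F′ L′ s) (a ∷ F) (c ∷ L) (suc j) (a∉F ∷ uF) (c∉L ∷ uL) d = record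
      { U = κ x ∷ core (toList F′) (toList L′) a c U ; V = V
      ; at-ins = trans
          (cong (λ b → prepend (κ x ∷ ι c ∷ firsts′ ++ lasts′) (prepend [ ι a ] b)) at-ins)
          (cong (λ u → block (κ x ∷ u) (Vec.map κ (firsts (at s j)) Vec.∷ʳ ι (lookup F j))
            (ι (lookup L j) ∷ Vec.map κ (lasts (at s j))) (ι (lookup F j) ∷ V)) before-eq)
      ; U-local = λ { {z} (p ∷ ps) → p ∘ κ-injective ∷ U-local′ z ps }
      ; V-local = V-local
      ; U∌first = ≢-sym ι≢κ ∷ core-All (toList F′) (toList L′) (λ _ → ≢-sym ι≢κ)
          (All.lookup a∉F (lookup∈ F j) ∘ ι-injective)
          (≢-sym (d (there (lookup∈ F j)) (here refl)) ∘ ι-injective) U∌first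
      ; V∌first = V∌first
      ; U∌last = ≢-sym ι≢κ ∷ core-All (toList F′) (toList L′) (λ _ → ≢-sym ι≢κ)
          (d (here refl) (there (lookup∈ L j)) ∘ ι-injective)
          (All.lookup c∉L (lookup∈ L j) ∘ ι-injective) U∌last
      ; V∌last = V∌last }
      where
      open Slot (slot s F L j uF uL (λ p q → d (there p) (there q)))
      firsts′ = toList (Vec.map κ F′ Vec.∷ʳ ι a)
      lasts′  = toList (ι c ∷ Vec.map κ L′)
      before-eq : ∀ {w} → (ι c ∷ firsts′ ++ lasts′) ++ ι a ∷ U ++ w ≡ core (toList F′) (toList L′) a c U ++ w
      before-eq {w} = trans (cong (ι c ∷_) (List.++-assoc firsts′ lasts′ _))
        (trans (flat-block F′ L′ a c (U ++ w)) (sym (core-++ (toList F′) (toList L′) a c U w)))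
      U-local′ : ∀ z → (toList F′ ++ toList L′) ++ before (at s j) ∌ z →
        core (toList F′) (toList L′) a c U ∌ κ z
      U-local′ z p =
        let q , r = All.++⁻ (toList F′ ++ toList L′) p
            qF , qL = All.++⁻ (toList F′) q
        in ι≢κ ∷ All.++⁺ (∌-map-injective κ-injective qF)
             (ι≢κ ∷ ι≢κ ∷ All.++⁺ (∌-map-injective κ-injective qL) (ι≢κ ∷ U-local r))

-- Replacing every block by a copy

module Expansion {A C T : Set} {m f : ℕ} (Z : Seq C m f) where

  Symbol : Set
  Symbol = A ⊎ (T × C)

  local : T → C → Symbol
  local t c = inj₂ (t , c)

  local-injective : ∀ {t b c} → local t b ≡ local t c → b ≡ c
  local-injective = ,-injectiveʳ ∘ inj₂-injective

  global≢local : ∀ {t a c} → _≢_ {A = Symbol} (inj₁ a) (local t c)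
  global≢local ()

  module Copy (t : T) = Insertion {A = A} {B = Symbol} inj₁ (local t)
  open Insertion using (module Slot)

  -- The tags name the copies. With a tag function the recursion can pass to `tag ∘ suc` while the
  -- type of symbols stays fixed.
  expand : (Fin g → T) → Seq A f g → Seq Symbol (suc m) (g * f)
  expand tag (one x)       = one (inj₁ x)
  expand tag (x ◂ s)       = inj₁ x ◂ expand tag s
  expand tag (blk x F L s) = inj₁ x ◂ Copy.ins (tag zero) Z F L +++ expand (tag ∘ suc) s

  expand-All : ∀ {I : Symbol → Set} (tag : Fin g → T) (s : Seq A f g) →
    (∀ t c → I (local (tag t) c)) → All (I ∘ inj₁) (flat s) → All I (flat (expand tag s))
  expand-All tag (one x) p (q ∷ []) = q ∷ []
  expand-All tag (x ◂ s) p (q ∷ qs) = q ∷ expand-All tag s p qs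
  expand-All tag (blk x F L s) p (q ∷ qs)
    rewrite flat-+++ (Copy.ins (tag zero) Z F L) (expand (tag ∘ suc) s) =
    let qF , qs′ = All.++⁻ (toList F) qs
        qL , qs″ = All.++⁻ (toList L) qs′
    in q ∷ All.++⁺ (Copy.ins-All (tag zero) Z F L (p zero) qF qL) (expand-All (tag ∘ suc) s (p ∘ suc) qs″)

  head-expand : ∀ (tag : Fin g → T) (s : Seq A f g) → head (expand tag s) ≡ inj₁ (head s)
  head-expand tag (one x)       = refl
  head-expand tag (x ◂ s)       = refl
  head-expand tag (blk x F L s) = refl

  length-expand : ∀ (tag : Fin g → T) (s : Seq A f g) →
    length (word (expand tag s)) ≡ length (word s) + g * (length (word Z) + 2 * f)
  length-expand tag (one x) = refl
  length-expand tag (x ◂ s) = cong suc (length-expand tag s)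
  length-expand {g = suc g} tag (blk x F L s) = cong suc (begin
    length (word (Copy.ins (tag zero) Z F L +++ expand (tag ∘ suc) s))
      ≡⟨ length-+++ (Copy.ins (tag zero) Z F L) _ ⟩
    length (word (Copy.ins (tag zero) Z F L)) + length (word (expand (tag ∘ suc) s))
      ≡⟨ cong₂ _+_ (Copy.length-ins (tag zero) Z F L) (length-expand (tag ∘ suc) s) ⟩
    ℓ + (length (word s) + g * ℓ)
      ≡⟨ sym (ℕ.+-assoc ℓ (length (word s)) (g * ℓ)) ⟩
    ℓ + length (word s) + g * ℓ
      ≡⟨ cong (_+ g * ℓ) (ℕ.+-comm ℓ (length (word s))) ⟩
    length (word s) + ℓ + g * ℓ
      ≡⟨ ℕ.+-assoc (length (word s)) ℓ (g * ℓ) ⟩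
    length (word s) + suc g * ℓ ∎)
    where
    open ≡-Reasoning
    ℓ = length (word Z) + 2 * f

  -- The context of the copy at block `t`: what is absent from Z* before or after the block stays
  -- absent from `P` or `Q`, and symbols of this copy cannot occur there because other copies bear
  -- other tags.
  record Placement (tag : Fin g → T) (s : Seq A f g) (t : Fin g) : Set where
    inserted : Seq Symbol (suc m) f
    inserted = Copy.ins (tag t) Z (firsts (at s t)) (lasts (at s t))
    field
      P Q         : List Symbol
      flat-expand : flat (expand tag s) ≡ P ++ flat inserted ++ Q
      at-expand   : ∀ j → at (expand tag s) (combine t j) ≡ prepend P (append (at inserted j) Q)
      P-global    : ∀ {z} → before (at s t) ∌ z → P ∌ inj₁ z
      Q-global    : ∀ {z} → after (at s t) ∌ z → Q ∌ inj₁ z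
      P-local     : ∀ {c} → P ∌ local (tag t) c
      Q-local     : ∀ {c} → Q ∌ local (tag t) c

  place : (tag : Fin g → T) → (∀ {i j} → tag i ≡ tag j → i ≡ j) →
    ∀ s t → Placement tag s t
  place tag inj (x ◂ s) t = record
    { P = inj₁ x ∷ P ; Q = Q
    ; flat-expand = cong (inj₁ x ∷_) flat-expand
    ; at-expand = λ j → cong (prepend [ inj₁ x ]) (at-expand j)
    ; P-global = λ { (p ∷ ps) → p ∘ inj₁-injective ∷ P-global ps }
    ; Q-global = Q-global
    ; P-local = global≢local ∷ P-local ; Q-local = Q-local }
    where open Placement (place tag inj s t)
  place tag inj (blk x F L s) zero = record
    { P = [ inj₁ x ] ; Q = flat rest
    ; flat-expand = cong (inj₁ x ∷_) (flat-+++ copy rest)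
    ; at-expand = λ j → cong (prepend [ inj₁ x ]) (at-↑ˡ copy rest j)
    ; P-global = λ { (p ∷ []) → p ∘ inj₁-injective ∷ [] }
    ; Q-global = λ p → expand-All (tag ∘ suc) s (λ _ _ → ≢-sym global≢local) (All.map (_∘ inj₁-injective) p)
    ; P-local = global≢local ∷ []
    ; Q-local = expand-All (tag ∘ suc) s (λ t _ eq → Fin.0≢1+n (sym (inj (,-injectiveˡ (inj₂-injective eq)))))
        (All.universal (λ _ → global≢local) (flat s)) }
    where
    copy = Copy.ins (tag zero) Z F L
    rest = expand (tag ∘ suc) s
  place tag inj (blk x F L s) (suc t) = record
    { P = inj₁ x ∷ flat copy ++ P ; Q = Q
    ; flat-expand = cong (inj₁ x ∷_) (trans (flat-+++ copy rest)
        (trans (cong (flat copy ++_) flat-expand) (sym (List.++-assoc (flat copy) P _))))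
    ; at-expand = λ j → cong (prepend [ inj₁ x ]) (trans (at-↑ʳ copy rest (combine t j))
        (trans (cong (prepend (flat copy)) (at-expand j)) (prepend-++ (flat copy) P _)))
    ; P-global = λ { (p ∷ ps) →
        let q , r = All.++⁻ (toList F ++ toList L) ps
            qF , qL = All.++⁻ (toList F) q
        in p ∘ inj₁-injective ∷
           All.++⁺ (Copy.ins-∌ (tag zero) inj₁-injective local-injective global≢local Z qF qL) (P-global r) }
    ; Q-global = Q-global
    ; P-local = global≢local ∷ All.++⁺ (Copy.ins-All (tag zero) Z F L
        (λ _ eq → Fin.0≢1+n (inj (,-injectiveˡ (inj₂-injective eq))))
        (All.universal (λ _ → global≢local) (toList F)) (All.universal (λ _ → global≢local) (toList L))) P-local
    ; Q-local = Q-local }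
    where
    copy = Copy.ins (tag zero) Z F L
    rest = expand (tag ∘ suc) s
    open Placement (place (tag ∘ suc) (Fin.suc-injective ∘ inj) s t)

  Other : A → A → Symbol → Set
  Other x y z = z ≢ inj₁ x × z ≢ inj₁ y

  -- If `x` and `y` both avoid the lasts of a block, the copy put there looks to them like its
  -- firsts with stutters, and the lasts count as deleted; if both avoid the firsts, the roles are
  -- exchanged.
  expand-traces : ∀ {x y} (tag : Fin g → T) (s : Seq A f g) →
    (∀ t → let b = at s t in
      (toList (lasts b) ∌ x × toList (lasts b) ∌ y) ⊎ (toList (firsts b) ∌ x × toList (firsts b) ∌ y)) →
    Traces inj₁ (Other x y) (flat s) (flat (expand tag s))
  expand-traces tag (one x) p = keep nil
  expand-traces tag (x ◂ s) p = keep (expand-traces tag s p)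
  expand-traces {x = a} {y = b} tag (blk x F L s) p
    rewrite flat-+++ (Copy.ins (tag zero) Z F L) (expand (tag ∘ suc) s) =
    keep (subst (λ u → Traces inj₁ (Other a b) u (flat copy ++ flat rest)) (List.++-assoc (toList F) (toList L) (flat s))
      (traces-++ (block-traces (p zero)) (expand-traces (tag ∘ suc) s (p ∘ suc))))
    where
    copy = Copy.ins (tag zero) Z F L
    rest = expand (tag ∘ suc) s
    locals : ∀ c → Other a b (local (tag zero) c)
    locals _ = (λ ()) , (λ ())
    globals : w ∌ a × w ∌ b → All (Other a b ∘ inj₁) w
    globals (q , r) = All.zipWith (λ (q , r) → q ∘ inj₁-injective , r ∘ inj₁-injective) (q , r)
    block-traces : (toList L ∌ a × toList L ∌ b) ⊎ (toList F ∌ a × toList F ∌ b) →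
      Traces inj₁ (Other a b) (toList F ++ toList L) (flat (Copy.ins (tag zero) Z F L))
    block-traces (inj₁ q) = subst (Traces inj₁ (Other a b) (toList F ++ toList L)) (List.++-identityʳ _)
      (traces-++ (Copy.ins-firsts (tag zero) Z F L locals (globals q))
        (subst (λ u → Traces inj₁ (Other a b) u []) (List.++-identityʳ (toList L)) (delete-all (toList L) nil)))
    block-traces (inj₂ q) = delete-all (toList F) (Copy.ins-lasts (tag zero) Z F L locals (globals q))

  -- A copy begins and ends with symbols of its own, while the plain symbols on both sides of the
  -- block belong to Z*.
  expand-proper : Proper Z → ∀ (tag : Fin g → T) (s : Seq A f g) →
    (∀ t {a c} → a ∈ toList (firsts (at s t)) → c ∈ toList (lasts (at s t)) → a ≢ c) →
    Proper s → Proper (expand tag s)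
  expand-proper pZ tag (one x) d p = tt
  expand-proper pZ tag (x ◂ s) d (x≢ , p) =
    subst (inj₁ x ≢_) (sym (head-expand tag s)) (x≢ ∘ inj₁-injective) , expand-proper pZ tag s d p
  expand-proper pZ tag (blk x F L s) d (x≢ , p) =
    subst (inj₁ x ≢_) (sym (trans (head-+++ copy rest) (Copy.head-ins (tag zero) Z F L))) global≢local ,
    proper-+++ copy rest
      (Copy.ins-proper (tag zero) inj₁-injective local-injective global≢local Z pZ (d zero))
      (λ eq → global≢local (sym (trans (sym (Copy.last-ins (tag zero) Z F L))
        (trans eq (head-expand (tag ∘ suc) s)))))
      (expand-proper pZ (tag ∘ suc) s (d ∘ suc) p)
    where
    copy = Copy.ins (tag zero) Z F L
    rest = expand (tag ∘ suc) s

  -- The expanded sequence is good again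

  module Expanded (good-Z : Good Z) (_≟ᴬ_ : DecidableEquality A) (_≟ᶜ_ : DecidableEquality C)
    (tag : Fin g → T) (tag-injective : ∀ {i j} → tag i ≡ tag j → i ≡ j)
    (tag-surjective : ∀ t → ∃ λ i → tag i ≡ t) (s : Seq A f g) (good-s : Good s) where

    open DecMembership _≟ᴬ_ using () renaming (_∈?_ to _∈ᴬ?_)
    open DecMembership _≟ᶜ_ using () renaming (_∈?_ to _∈ᶜ?_)

    E : List Symbol
    E = flat (expand tag s)

    module At (t : Fin g) where
      open Placement (place tag tag-injective s t) public
      F = firsts (at s t)
      L = lasts (at s t)
      open Valid (valid good-s t) public
        renaming (first-new to F-new; last-final to L-final; first-unique to F-unique; last-unique to L-unique;
          disjoint to FL-disjoint)

      module In (j : Fin f) where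
        open Slot (Copy.slot (tag t) inj₁-injective local-injective global≢local Z F L j
          F-unique L-unique FL-disjoint) public
        open Valid (valid good-Z j) public
          renaming (first-new to F′-new; last-final to L′-final; first-unique to F′-unique;
            last-unique to L′-unique; disjoint to F′L′-disjoint)
        a  = lookup F j
        c  = lookup L j
        F′ = toList (firsts (at Z j))
        L′ = toList (lasts (at Z j))

        a∈F : a ∈ toList F
        a∈F = lookup∈ F j

        c∈L : c ∈ toList L
        c∈L = lookup∈ L j

        a≢c : a ≢ c
        a≢c = FL-disjoint a∈F c∈L

        F′-global : ∀ {z} → List.map (local (tag t)) F′ ∌ inj₁ z
        F′-global = ∌-map F′ (λ _ → ≢-sym global≢local)

        L′-global : ∀ {z} → List.map (local (tag t)) L′ ∌ inj₁ z
        L′-global = ∌-map L′ (λ _ → ≢-sym global≢local)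

        flat-E : E ≡ P ++ U ++ Copy.core (tag t) F′ L′ a c (V ++ Q)
        flat-E = trans flat-expand (cong (P ++_) (trans (cong (_++ Q) flat-slot)
          (trans (List.++-assoc U _ Q) (cong (U ++_) (Copy.core-++ (tag t) F′ L′ a c V Q)))))

        -- In c F′ a c L′ a the block holds the first a, with the plain one after it, and the last
        -- c, with the plain one before it; so a is new and c is final. The local symbols inherit
        -- both properties from Z.
        valid-E : Valid (at (expand tag s) (combine t j))
        valid-E rewrite at-expand j | at-ins = record
          { first-new = λ z∈ → new (subst (_ ∈_) firsts-eq z∈)
          ; last-final = λ {z} z∈ → final (subst (z ∈_) lasts-eq z∈)
          ; first-unique = subst Unique (sym firsts-eq)
              (Unique.++⁺ (Unique.map⁺ local-injective F′-unique) ([] ∷ [])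
                λ { (z∈ , here refl) → All.lookup (F′-global {a}) z∈ refl })
          ; last-unique = subst Unique (sym lasts-eq)
              (All.map ≢-sym (L′-global {c}) ∷ Unique.map⁺ local-injective L′-unique)
          ; disjoint = λ {_} {z} p q → apart (subst (_ ∈_) firsts-eq p) (subst (z ∈_) lasts-eq q) }
          where
          firsts-eq = Copy.toList-firsts (tag t) (firsts (at Z j)) (inj₁ a)
          lasts-eq : inj₁ c ∷ toList (Vec.map (local (tag t)) (lasts (at Z j))) ≡ inj₁ c ∷ List.map (local (tag t)) L′
          lasts-eq = cong (inj₁ c ∷_) (Vec.toList-map _ (lasts (at Z j)))
          new : ∀ {z} → z ∈ List.map (local (tag t)) F′ ++ [ inj₁ a ] → P ++ U ++ [ inj₁ c ] ∌ z
          new z∈ with ∈-++⁻ (List.map (local (tag t)) F′) z∈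
          ... | inj₁ z∈F′ with ∈-map⁻ (local (tag t)) z∈F′
          ...   | b , b∈F′ , refl = All.++⁺ P-local (All.++⁺ (U-local (F′-new b∈F′)) (global≢local ∷ []))
          new z∈ | inj₂ (here refl) =
            All.++⁺ (P-global (F-new a∈F)) (All.++⁺ U∌first (≢-sym a≢c ∘ inj₁-injective ∷ []))
          final : ∀ {z} → z ∈ inj₁ c ∷ List.map (local (tag t)) L′ → (inj₁ a ∷ V) ++ Q ∌ z
          final (here refl) = a≢c ∘ inj₁-injective ∷ All.++⁺ V∌last (Q-global (L-final c∈L))
          final (there z∈) with ∈-map⁻ (local (tag t)) z∈
          ... | b , b∈L′ , refl = global≢local ∷ All.++⁺ (V-local (L′-final b∈L′)) Q-local
          apart : ∀ {y z} → y ∈ List.map (local (tag t)) F′ ++ [ inj₁ a ] →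
            z ∈ inj₁ c ∷ List.map (local (tag t)) L′ → y ≢ z
          apart y∈ z∈ with ∈-++⁻ (List.map (local (tag t)) F′) y∈ | z∈
          ... | inj₁ y∈F′ | here refl = All.lookup (F′-global {c}) y∈F′
          ... | inj₁ y∈F′ | there z∈L′ with ∈-map⁻ (local (tag t)) y∈F′ | ∈-map⁻ (local (tag t)) z∈L′
          ...   | b , b∈F′ , refl | d , d∈L′ , refl = F′L′-disjoint b∈F′ d∈L′ ∘ local-injective
          apart y∈ z∈ | inj₂ (here refl) | here refl = a≢c ∘ inj₁-injective
          apart y∈ z∈ | inj₂ (here refl) | there z∈L′ = ≢-sym (All.lookup (L′-global {a}) z∈L′)

        -- If b ∈ L′ then no b follows L′; otherwise  a c L′ a  misses b. The proof of
        -- last-local is the mirror image, with F′ in place of L′.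
        first-local : ∀ b → FourRuns (inj₁ a) (local (tag t) b) E
        first-local b rewrite flat-E with b ∈ᶜ? L′
        ... | no b∉L′ = inj₂ (cover (P-global (F-new a∈F)) (cover U∌first (step (≢-sym a≢c ∘ inj₁-injective)
          (cover F′-global (turn (step global≢local (step global≢local
          (cover (∌-map-injective local-injective (∉⇒∌ b∉L′)) (step global≢local
          (turn (cover V∌first (turn (missing Q-local)))))))))))))
        ... | yes b∈L′ = inj₂ (cover (P-global (F-new a∈F)) (cover U∌first (step (≢-sym a≢c ∘ inj₁-injective)
          (cover F′-global (turn (step global≢local (step global≢local
          (turn (cover L′-global (turn (step global≢local
          (missing (All.++⁺ (V-local (L′-final b∈L′)) Q-local)))))))))))))

        last-local : ∀ b → FourRuns (inj₁ c) (local (tag t) b) E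
        last-local b rewrite flat-E with b ∈ᶜ? F′
        ... | no b∉F′ = inj₁ (cover P-local (turn (cover U∌last (turn (step global≢local
          (cover (∌-map-injective local-injective (∉⇒∌ b∉F′)) (step global≢local (step global≢local
          (turn (cover L′-global (step (a≢c ∘ inj₁-injective)
          (missing (All.++⁺ V∌last (Q-global (L-final c∈L)))))))))))))))
        ... | yes b∈F′ = inj₁ (cover P-local (cover (U-local (F′-new b∈F′)) (step global≢local
          (turn (cover F′-global (step (a≢c ∘ inj₁-injective) (turn (step global≢local
          (turn (cover L′-global (step (a≢c ∘ inj₁-injective)
          (missing (All.++⁺ V∌last (Q-global (L-final c∈L)))))))))))))))

        -- The segments missing a and z in turn are P U c | F′ a | c L′ | a V Q if z = c, and P U c
        -- F′ | a c L′ a | V | Q otherwise.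
        first-last : ∀ {z} → z ∈ toList L → FourRuns (inj₁ a) (inj₁ z) E
        first-last {z} z∈L rewrite flat-E with z ≟ᴬ c
        ... | yes refl = inj₂ (cover (P-global (F-new a∈F)) (cover U∌first (step (≢-sym a≢c ∘ inj₁-injective)
          (turn (cover F′-global (step (a≢c ∘ inj₁-injective) (turn (step (≢-sym a≢c ∘ inj₁-injective)
          (cover L′-global (turn (step (a≢c ∘ inj₁-injective)
          (missing (All.++⁺ V∌last (Q-global (L-final c∈L)))))))))))))))
        ... | no z≢c = inj₂ (cover (P-global (F-new a∈F)) (cover U∌first (step (≢-sym a≢c ∘ inj₁-injective)
          (cover F′-global (turn (step (a≢z ∘ inj₁-injective) (step (≢-sym z≢c ∘ inj₁-injective)
          (cover L′-global (step (a≢z ∘ inj₁-injective)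
          (turn (cover V∌first (turn (missing (Q-global (L-final z∈L)))))))))))))))
          where
          a≢z : a ≢ z
          a≢z = FL-disjoint a∈F z∈L

    first-last : ∀ t {x y} → x ∈ toList (firsts (at s t)) → y ∈ toList (lasts (at s t)) →
      FourRuns (inj₁ x) (inj₁ y) E
    first-last t x∈F y∈L with index-of (firsts (at s t)) x∈F
    ... | j , refl = At.In.first-last t j y∈L

    conflict? : ∀ x y → Dec (∃ λ t → let b = at s t in
      (x ∈ toList (firsts b) × y ∈ toList (lasts b)) ⊎ (y ∈ toList (firsts b) × x ∈ toList (lasts b)))
    conflict? x y = Fin.any? (λ t →
      ((x ∈ᴬ? toList (firsts (at s t))) ×-dec (y ∈ᴬ? toList (lasts (at s t)))) ⊎-dec
      ((y ∈ᴬ? toList (firsts (at s t))) ×-dec (x ∈ᴬ? toList (lasts (at s t)))))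

    -- Two symbols of Z* conflict when some block has one among its firsts and the other among its
    -- lasts; then the cuts are made around that block. Without a conflict the expansion only
    -- stutters and deletes these symbols, and the cuts of Z* carry over.
    global-global : ∀ {x y} → x ≢ y → FourRuns (inj₁ x) (inj₁ y) E
    global-global {x} {y} x≢y with conflict? x y
    ... | yes (t , inj₁ (p , q)) = first-last t p q
    ... | yes (t , inj₂ (p , q)) = swap (first-last t p q)
    ... | no ¬conflict = fourRuns-transfer inj₁-injective proj₁ proj₂ (expand-traces tag s one-sided)
      (four-runs good-s x≢y)
      where
      one-sided : ∀ t → let b = at s t in
        (toList (lasts b) ∌ x × toList (lasts b) ∌ y) ⊎ (toList (firsts b) ∌ x × toList (firsts b) ∌ y)
      one-sided t with x ∈ᴬ? toList (lasts (at s t)) | y ∈ᴬ? toList (lasts (at s t))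
      -- A symbol in the lasts keeps both symbols out of the firsts: itself by disjointness, the
      -- other because it would conflict.
      ... | yes x∈L | _       = inj₂ (∉⇒∌ (λ x∈F → At.FL-disjoint t x∈F x∈L refl) ,
                                      ∉⇒∌ (λ y∈F → ¬conflict (t , inj₂ (y∈F , x∈L))))
      ... | no _    | yes y∈L = inj₂ (∉⇒∌ (λ x∈F → ¬conflict (t , inj₁ (x∈F , y∈L))) ,
                                      ∉⇒∌ (λ y∈F → At.FL-disjoint t y∈F y∈L refl))
      ... | no x∉L  | no y∉L  = inj₁ (∉⇒∌ x∉L , ∉⇒∌ y∉L)

    -- If `x` is in neither list of block `t`, it is absent from the copy there, and the local
    -- symbol is absent outside; then P | copy | Q is enough, and `relax` supplies the fourth
    -- segment.
    global-local : ∀ x t b → FourRuns (inj₁ x) (local (tag t) b) E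
    global-local x t b with x ∈ᴬ? toList (firsts (at s t)) | x ∈ᴬ? toList (lasts (at s t))
    ... | yes x∈F | _ with index-of (firsts (at s t)) x∈F
    ...   | j , refl = At.In.first-local t j b
    global-local x t b | no _ | yes x∈L with index-of (lasts (at s t)) x∈L
    ...   | j , refl = At.In.last-local t j b
    global-local x t b | no x∉F | no x∉L rewrite At.flat-expand t =
      inj₁ (cover P-local (turn (cover inserted∌ (turn (relax (missing Q-local))))))
      where
      open At t
      inserted∌ : flat inserted ∌ inj₁ x
      inserted∌ = Copy.ins-∌ (tag t) inj₁-injective local-injective global≢local Z (∉⇒∌ x∉F) (∉⇒∌ x∉L)

    local-same : ∀ t {b d} → b ≢ d → FourRuns (local (tag t) b) (local (tag t) d) E
    local-same t {b} {d} b≢d rewrite At.flat-expand t =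
      fourRuns-transfer local-injective id′ id′
        (insert-all P-foreign (subst (λ u → Traces (local (tag t)) Foreign u (flat inserted ++ Q))
          (List.++-identityʳ (flat Z)) (traces-++ (Copy.ins-locals (tag t) Z F L (λ _ _ → global≢local))
            (subst (Traces (local (tag t)) Foreign []) (List.++-identityʳ Q) (insert-all Q-foreign nil)))))
        (four-runs good-Z b≢d)
      where
      open At t
      Foreign : Symbol → Set
      Foreign z = ∀ c → z ≢ local (tag t) c
      id′ : ∀ {z c} → Foreign z → z ≢ local (tag t) c
      id′ p = p _
      P-foreign : All Foreign P
      P-foreign = All.tabulate (λ z∈P _ → All.lookup P-local z∈P)
      Q-foreign : All Foreign Q
      Q-foreign = All.tabulate (λ z∈Q _ → All.lookup Q-local z∈Q)

    -- Cut around the first of the two copies: it misses the symbols of the other one, and the rest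
    -- misses its own.
    local-other : ∀ t t′ {b d} → t ≢ t′ → FourRuns (local (tag t) b) (local (tag t′) d) E
    local-other t t′ t≢t′ rewrite At.flat-expand t =
      inj₂ (cover P-local (turn (cover
        (Copy.ins-All (tag t) Z F L (λ _ eq → t≢t′ (tag-injective (,-injectiveˡ (inj₂-injective eq))))
          (All.universal (λ _ → global≢local) (toList F)) (All.universal (λ _ → global≢local) (toList L)))
        (turn (relax (missing Q-local))))))
      where open At t

    all-runs : ∀ {x y} → x ≢ y → FourRuns x y E
    all-runs {inj₁ x} {inj₁ y} x≢y = global-global (x≢y ∘ cong inj₁)
    all-runs {inj₁ x} {inj₂ (t , b)} _ with tag-surjective t
    ... | i , refl = global-local x i b
    all-runs {inj₂ (t , b)} {inj₁ x} _ with tag-surjective t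
    ... | i , refl = swap (global-local x i b)
    all-runs {inj₂ (t , b)} {inj₂ (t′ , d)} x≢y with tag-surjective t | tag-surjective t′
    ... | i , refl | j , refl with i Fin.≟ j
    ...   | yes refl = local-same i (x≢y ∘ cong (local (tag i)))
    ...   | no i≢j   = local-other i j i≢j

    expand-good : Good (expand tag s)
    expand-good = record
      { four-runs = all-runs
      ; valid = valid-all
      ; proper = expand-proper (proper good-Z) tag s (λ t → At.FL-disjoint t) (proper good-s) }
      where
      valid-all : ∀ i → Valid (at (expand tag s) i)
      valid-all i with Fin.combine-surjective {g} {f} i
      ... | t , j , refl = At.In.valid-E t j

-- The base of the construction

-- The number is only an upper bound for the occurrences, as `none` accepts any `k`.
data Occ {A : Set} (x : A) : ℕ → List A → Set where
  none : Occ x k []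
  miss : z ≢ x → Occ x k w → Occ x k (z ∷ w)
  hit  : Occ x k w → Occ x (suc k) (x ∷ w)

∌⇒occ : w ∌ x → Occ x k w
∌⇒occ []       = none
∌⇒occ (p ∷ ps) = miss p (∌⇒occ ps)

occ-suc : Occ x k w → Occ x (suc k) w
occ-suc none       = none
occ-suc (miss p o) = miss p (occ-suc o)
occ-suc (hit o)    = hit (occ-suc o)

occ-++ : ∀ {j} → Occ x j u → Occ x k v → Occ x (j + k) (u ++ v)
occ-++ {j = zero}  none       o′ = o′
occ-++ {j = suc j} none       o′ = occ-suc (occ-++ {j = j} none o′)
occ-++             (miss p o) o′ = miss p (occ-++ o o′)
occ-++             (hit o)    o′ = hit (occ-++ o o′)

unique⇒occ : DecidableEquality A → ∀ (x : A) {w} → Unique w → Occ x 1 w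
unique⇒occ _≟_ x []           = none
unique⇒occ _≟_ x (_∷_ {z} z∉ uw) with z ≟ x
... | yes refl = hit (∌⇒occ (All.map ≢-sym z∉))
... | no z≢x   = miss z≢x (unique⇒occ _≟_ x uw)

occ⇒runs : x ≢ y → Occ x k w → Runs y x (k * 2) w
occ⇒runs x≢y none       = stop
occ⇒runs x≢y (miss p o) = step p (occ⇒runs x≢y o)
occ⇒runs x≢y (hit o)    = turn (step x≢y (turn (occ⇒runs x≢y o)))

-- The symbol that comes first spends one occurrence in the first segment. Its one possible further
-- occurrence cuts the rest into three.
occ⇒fourRuns : x ≢ y → Occ x 2 w → Occ y 2 w → FourRuns x y w
occ⇒fourRuns x≢y none       none       = inj₁ stop
occ⇒fourRuns x≢y (miss p o) (miss q o′) = Sum.map (step q) (step p) (occ⇒fourRuns x≢y o o′)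
occ⇒fourRuns x≢y (hit o)    (miss q o′) = inj₁ (step x≢y (turn (occ⇒runs x≢y o)))
occ⇒fourRuns x≢y (miss p o) (hit o′)    = inj₂ (step p (turn (occ⇒runs (≢-sym x≢y) o′)))
occ⇒fourRuns x≢y (hit o)    (hit o′)    = ⊥-elim (x≢y refl)

module _ {R : Set} where

  -- Row r consists of a separator (r , zero) and of m cells; the cells of each row
  -- start in one block of the chain and end in the next one.
  cells : R → Vec (R × Fin (suc m)) m
  cells r = Vec.tabulate (λ i → r , suc i)

  cells⁻ : ∀ {r : R} {z : R × Fin (suc m)} → z ∈ toList (cells r) → ∃ λ i → z ≡ (r , suc i)
  cells⁻ {r = r} z∈ with index-of (cells r) z∈
  ... | i , refl = i , Vec.lookup∘tabulate (λ i → r , suc i) i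

  cells-∌ : ∀ {r r′ : R} {i : Fin (suc m)} → r ≢ r′ → toList (cells r) ∌ (r′ , i)
  cells-∌ r≢r′ = ∈⇒∌ (λ z∈ eq → r≢r′ (,-injectiveˡ (trans (sym (proj₂ (cells⁻ z∈))) eq)))

  cells-unique : ∀ (r : R) → Unique (toList (cells {m = m} r))
  cells-unique r = tabulate-unique (λ i → r , suc i) (Fin.suc-injective ∘ ,-injectiveʳ)
    where
    tabulate-unique : ∀ {n} (h : Fin n → A) → (∀ {i j} → h i ≡ h j → i ≡ j) → Unique (toList (Vec.tabulate h))
    tabulate-unique {n = zero}  h inj = []
    tabulate-unique {n = suc n} h inj =
      All.tabulate (λ z∈ eq → Fin.0≢1+n (inj (trans eq (sym (trans (sym (Vec.lookup∘tabulate (h ∘ suc) _))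
        (proj₂ (index-of (Vec.tabulate (h ∘ suc)) z∈)))))))
      ∷ tabulate-unique (h ∘ suc) (Fin.suc-injective ∘ inj)

  chain : ∀ {q} → (Fin (suc q) → R) → Seq (R × Fin (suc m)) m q
  chain {q = zero}  row = one (row zero , zero)
  chain {q = suc q} row = blk (row zero , zero) (cells (row (suc zero))) (cells (row zero)) (chain (row ∘ suc))

  chain-∌ : ∀ {q} (row : Fin (suc q) → R) {r} {i : Fin (suc m)} →
    (∀ t → row t ≢ r) → flat (chain row) ∌ (r , i)
  chain-∌ {q = zero}  row p = p zero ∘ ,-injectiveˡ ∷ []
  chain-∌ {q = suc q} row p = p zero ∘ ,-injectiveˡ ∷
    All.++⁺ (cells-∌ (p (suc zero))) (All.++⁺ (cells-∌ (p zero)) (chain-∌ (row ∘ suc) (p ∘ suc)))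

  chain-firsts : ∀ {q} (row : Fin (suc q) → R) t →
    firsts (at (chain {m = m} row) t) ≡ cells (row (suc t))
  chain-firsts {q = suc q} row zero    = refl
  chain-firsts {q = suc q} row (suc t) = chain-firsts (row ∘ suc) t

  module _ (_≟ᴿ_ : DecidableEquality R) where

    _≟ˢ_ : DecidableEquality (R × Fin (suc m))
    _≟ˢ_ = Product.≡-dec _≟ᴿ_ Fin._≟_

    module _ {q} (row : Fin (suc (suc q)) → R) (row-injective : ∀ {i j} → row i ≡ row j → i ≡ j) where

      link : List (R × Fin (suc m))
      link = (row zero , zero) ∷ toList (cells (row (suc zero))) ++ toList (cells (row zero))

      row₀∉ : ∀ t → row (suc t) ≢ row zero
      row₀∉ t eq = Fin.0≢1+n (sym (row-injective eq))

      link-∌ : ∀ {r} {i : Fin (suc m)} → row zero ≢ r → row (suc zero) ≢ r → link ∌ (r , i)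
      link-∌ p q = p ∘ ,-injectiveˡ ∷ All.++⁺ (cells-∌ q) (cells-∌ p)

      link-unique : Unique (link {m = m})
      link-unique = All.map ≢-sym (All.++⁺ (cells-∌ (row₀∉ zero))
          (∈⇒∌ (λ z∈ eq → Fin.0≢1+n (sym (,-injectiveʳ (trans (sym (proj₂ (cells⁻ z∈))) eq))))))
        ∷ Unique.++⁺ (cells-unique _) (cells-unique _)
            (λ (p , q) → row₀∉ zero (,-injectiveˡ (trans (sym (proj₂ (cells⁻ p))) (proj₂ (cells⁻ q)))))

      flat-link : flat (chain {m = m} row) ≡ link ++ flat (chain (row ∘ suc))
      flat-link = cong ((row zero , zero) ∷_) (sym (List.++-assoc (toList (cells (row (suc zero)))) _ _))

    -- The first row starts in no block: its separator and its cells can only occur in the first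
    -- link.
    chain-occ₁ : ∀ {q} (row : Fin (suc q) → R) → (∀ {i j} → row i ≡ row j → i ≡ j) →
      ∀ {m} (i : Fin (suc m)) → Occ (row zero , i) 1 (flat (chain row))
    chain-occ₁ {q = zero}  row inj i = unique⇒occ _≟ˢ_ _ ([] ∷ [])
    chain-occ₁ {q = suc q} row inj {m} i rewrite flat-link row inj {m = m} =
      occ-++ (unique⇒occ _≟ˢ_ _ (link-unique row inj)) (∌⇒occ {k = 0} (chain-∌ (row ∘ suc) (row₀∉ row inj)))

    -- A symbol of the second row occurs at most once in the first link and, belonging to the first
    -- row of the remaining chain, at most once there.
    chain-occ₂ : ∀ {q} (row : Fin (suc q) → R) → (∀ {i j} → row i ≡ row j → i ≡ j) →
      ∀ {m} (x : R × Fin (suc m)) → Occ x 2 (flat (chain row))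
    chain-occ₂ {q = zero}  row inj x = occ-suc (unique⇒occ _≟ˢ_ _ ([] ∷ []))
    chain-occ₂ {q = suc q} row inj {m} (r , i) with row zero ≟ᴿ r | row (suc zero) ≟ᴿ r
    ... | yes refl | _ = occ-suc (chain-occ₁ row inj i)
    ... | no _ | yes refl rewrite flat-link row inj {m = m} =
      occ-++ (unique⇒occ _≟ˢ_ _ (link-unique row inj)) (chain-occ₁ (row ∘ suc) (Fin.suc-injective ∘ inj) i)
    ... | no r₀≢ | no r₁≢ rewrite flat-link row inj {m = m} =
      occ-++ (∌⇒occ {k = 0} (link-∌ row inj r₀≢ r₁≢)) (chain-occ₂ (row ∘ suc) (Fin.suc-injective ∘ inj) (r , i))

    chain-valid : ∀ {q} (row : Fin (suc q) → R) → (∀ {i j} → row i ≡ row j → i ≡ j) →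
      ∀ t → Valid (at (chain {m = m} row) t)
    chain-valid {q = suc q} row inj zero = record
      { first-new = λ a∈ → subst (_ ∌_) (sym (proj₂ (cells⁻ a∈))) (≢-sym (row₀∉ row inj zero) ∘ ,-injectiveˡ ∷ [])
      ; last-final = λ a∈ → subst (_ ∌_) (sym (proj₂ (cells⁻ a∈))) (chain-∌ (row ∘ suc) (row₀∉ row inj))
      ; first-unique = cells-unique _
      ; last-unique = cells-unique _
      ; disjoint = λ p q eq → row₀∉ row inj zero
          (,-injectiveˡ (trans (sym (proj₂ (cells⁻ p))) (trans eq (proj₂ (cells⁻ q))))) }
    chain-valid {q = suc q} row inj (suc t) = record
      { first-new = λ a∈ → All.++⁺ (new a∈) (Valid.first-new rest a∈)
      ; last-final = Valid.last-final rest
      ; first-unique = Valid.first-unique rest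
      ; last-unique = Valid.last-unique rest
      ; disjoint = Valid.disjoint rest }
      where
      rest = chain-valid (row ∘ suc) (Fin.suc-injective ∘ inj) t
      new : ∀ {a} → a ∈ toList (firsts (at (chain (row ∘ suc)) t)) → link row inj ∌ a
      new {a} a∈ with cells⁻ {r = row (suc (suc t))} (subst (λ F → a ∈ toList F) (chain-firsts (row ∘ suc) t) a∈)
      ... | i , refl = link-∌ row inj (Fin.0≢1+n ∘ inj) (Fin.0≢1+n ∘ Fin.suc-injective ∘ inj)

    chain-proper : ∀ {q} (row : Fin (suc q) → R) → (∀ {i j} → row i ≡ row j → i ≡ j) →
      Proper (chain {m = m} row)
    chain-proper {q = zero}        row inj = tt
    chain-proper {q = suc zero}    row inj = Fin.0≢1+n ∘ inj ∘ ,-injectiveˡ , tt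
    chain-proper {q = suc (suc q)} row inj =
      Fin.0≢1+n ∘ inj ∘ ,-injectiveˡ , chain-proper (row ∘ suc) (Fin.suc-injective ∘ inj)

    chain-good : ∀ {q} (row : Fin (suc q) → R) → (∀ {i j} → row i ≡ row j → i ≡ j) →
      Good (chain {m = m} row)
    chain-good row inj = record
      { four-runs = λ {x} {y} x≢y → occ⇒fourRuns x≢y (chain-occ₂ row inj x) (chain-occ₂ row inj y)
      ; valid = chain-valid row inj
      ; proper = chain-proper row inj }

-- Sequences with bounds on alphabet and length

record Fan (m f T ℓ : ℕ) : Set₁ where
  field
    Alphabet       : Set
    _≟_            : DecidableEquality Alphabet
    -- An injection is enough: `T` has to bound the number of symbols from above only, just as `ℓ`
    -- bounds the length from below.
    code           : Alphabet → Fin T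
    code-injective : ∀ {a b} → code a ≡ code b → a ≡ b
    seq            : Seq Alphabet m f
    good           : Good seq
    long           : ℓ ≤ length (word seq)

chain-fan : ∀ q m → Fan m q (suc q * suc m) 0
chain-fan q m = record
  { Alphabet = Fin (suc q) × Fin (suc m)
  ; _≟_ = Product.≡-dec Fin._≟_ Fin._≟_
  ; code = λ (r , i) → combine r i
  ; code-injective = λ { {r , i} {r′ , i′} eq → let p , q = Fin.combine-injective r i r′ i′ eq in cong₂ _,_ p q }
  ; seq = chain id
  ; good = chain-good Fin._≟_ id id
  -- The separators are given away; they are too few to matter.
  ; long = z≤n }

expand-fan : ∀ {T T′ ℓ ℓ′} → Fan m f T′ ℓ′ → Fan f g T ℓ →
  Fan (suc m) (g * f) (T + g * T′) (ℓ + g * (ℓ′ + 2 * f))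
expand-fan {f = f} {g = g} {T = T} {T′ = T′} {ℓ} {ℓ′} Z Z* = record
  { Alphabet = Z*.Alphabet ⊎ (Fin g × Z.Alphabet)
  ; _≟_ = Sum.≡-dec Z*._≟_ (Product.≡-dec Fin._≟_ Z._≟_)
  ; code = code
  ; code-injective = code-injective
  ; seq = expand id Z*.seq
  ; good = Expanded.expand-good Z.good Z*._≟_ Z._≟_ id id (λ t → t , refl) Z*.seq Z*.good
  ; long = subst (ℓ + g * (ℓ′ + 2 * f) ≤_) (sym (length-expand id Z*.seq))
      (ℕ.+-mono-≤ Z*.long (ℕ.*-monoʳ-≤ g (ℕ.+-monoˡ-≤ (2 * f) Z.long))) }
  where
  module Z = Fan Z
  module Z* = Fan Z*
  open Expansion {T = Fin g} Z.seq
  code : Z*.Alphabet ⊎ (Fin g × Z.Alphabet) → Fin (T + g * T′)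
  code (inj₁ a)       = Z*.code a ↑ˡ (g * T′)
  code (inj₂ (t , b)) = T ↑ʳ combine t (Z.code b)
  apart : ∀ i j → i ↑ˡ (g * T′) ≢ T ↑ʳ j
  apart i j eq with trans (sym (Fin.splitAt-↑ˡ T i (g * T′))) (trans (cong (splitAt T) eq) (Fin.splitAt-↑ʳ T (g * T′) j))
  ... | ()
  code-injective : ∀ {a b} → code a ≡ code b → a ≡ b
  code-injective {inj₁ a} {inj₁ b} eq = cong inj₁ (Z*.code-injective (Fin.↑ˡ-injective (g * T′) _ _ eq))
  code-injective {inj₁ a} {inj₂ b} eq = ⊥-elim (apart _ _ eq)
  code-injective {inj₂ a} {inj₁ b} eq = ⊥-elim (apart _ _ (sym eq))
  code-injective {inj₂ (t , a)} {inj₂ (t′ , b)} eq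
    with Fin.combine-injective t (Z.code a) t′ (Z.code b) (Fin.↑ʳ-injective T _ _ eq)
  ... | refl , eq′ = cong (λ b → inj₂ (t , b)) (Z.code-injective eq′)

word-traces : ∀ {h : A → B} {I} (s : Seq A m f) → Traces h I (flat s) (List.map h (word s))
word-traces (one x)       = keep nil
word-traces (x ◂ s)       = keep (word-traces s)
word-traces (blk x F L s) = keep (delete-all (toList F) (delete-all (toList L) (word-traces s)))

module _ {h : A → B} (h-injective : ∀ {a b} → h a ≡ h b → a ≡ b) where

  linked-∷ : ∀ (s : Seq A m f) → x ≢ head s →
    Linked _≢_ (List.map h (word s)) → Linked _≢_ (h x ∷ List.map h (word s))
  linked-∷ (one _)       x≢ l = x≢ ∘ h-injective ∷ l
  linked-∷ (_ ◂ _)       x≢ l = x≢ ∘ h-injective ∷ l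
  linked-∷ (blk _ _ _ _) x≢ l = x≢ ∘ h-injective ∷ l

  proper⇒linked : ∀ (s : Seq A m f) → Proper s → Linked _≢_ (List.map h (word s))
  proper⇒linked (one x)       _        = [-]
  proper⇒linked (x ◂ s)       (x≢ , p) = linked-∷ s x≢ (proper⇒linked s p)
  proper⇒linked (blk x F L s) (x≢ , p) = linked-∷ s x≢ (proper⇒linked s p)

fan⇒DS : ∀ {T ℓ n} → Fan m f T ℓ → T ≤ n → Σ (List (Fin n)) λ w → DS 3 w × ℓ ≤ length w
fan⇒DS Z T≤n = List.map h (word seq) , (proper⇒linked h-injective seq (proper good) , no-alt) ,
  subst (_ ≤_) (sym (List.length-map h (word seq))) long
  where
  open Fan Z hiding (_≟_)
  h = λ a → inject≤ (code a) T≤n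
  h-injective : ∀ {a b} → h a ≡ h b → a ≡ b
  h-injective = code-injective ∘ Fin.inject≤-injective T≤n T≤n _ _
  open DecMembership Fin._≟_ using (_∈?_)
  no-alt : ∀ a b → a ≢ b → ¬ (alt a b 5 ⊆ List.map h (word seq))
  -- A symbol that does not occur leaves the word as one single segment. Symbols that occur are
  -- images under `h`, and since `word` arises from `flat` by deletion alone, the class of inserted
  -- letters can be empty.
  no-alt a b a≢b with a ∈? List.map h (word seq) | b ∈? List.map h (word seq)
  ... | no a∉ | _ = fourRuns⇒¬alt (inj₂ (missing (∉⇒∌ a∉)))
  ... | yes _ | no b∉ = fourRuns⇒¬alt (inj₁ (missing (∉⇒∌ b∉)))
  ... | yes a∈ | yes b∈ with ∈-map⁻ h a∈ | ∈-map⁻ h b∈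
  ...   | x , _ , refl | y , _ , refl = fourRuns⇒¬alt
    (fourRuns-transfer {I = λ _ → ⊥} h-injective (λ ()) (λ ()) (word-traces seq) (four-runs good (a≢b ∘ cong h)))

-- Counting

-- The parameters of `fan d m`, the sequence Z d m. For d = 0 it is a chain of 3 + m rows; for
-- positive d and m = 0 it is a single empty block between two symbols.
blocks : ℕ → ℕ → ℕ
blocks zero    m       = 2 + m
blocks (suc d) zero    = 1
blocks (suc d) (suc m) = blocks d (blocks (suc d) m) * blocks (suc d) m

size : ℕ → ℕ → ℕ
size zero    m       = (3 + m) * suc m
size (suc d) zero    = 2
size (suc d) (suc m) = let φ = blocks (suc d) m in size d φ + blocks d φ * size (suc d) m

len : ℕ → ℕ → ℕ
len zero    m       = 0
len (suc d) zero    = 0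
len (suc d) (suc m) = let φ = blocks (suc d) m in len d φ + blocks d φ * (len (suc d) m + 2 * φ)

fan : ∀ d m → Fan m (blocks d m) (size d m) (len d m)
fan zero    m       = chain-fan (2 + m) m
fan (suc d) zero    = chain-fan 1 0
fan (suc d) (suc m) = expand-fan (fan (suc d) m) (fan d (blocks (suc d) m))

-- Compared with `size-bound`, this is an average of about 2 d occurrences per symbol. In the
-- inductive step the inserted 2 φ per copy raise the share 2 d φ γ of Z* to 2 (d + 1) φ γ.
len-bound : ∀ d m → 2 * d * m * blocks d m ≤ len d m
len-bound zero    m       = z≤n
len-bound (suc d) zero    = ℕ.≤-reflexive (cong (_* 1) (ℕ.*-zeroʳ (2 * suc d)))
len-bound (suc d) (suc m) = begin
  2 * suc d * suc m * (γ * φ)                           ≡⟨ arith d m φ γ ⟩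
  2 * d * φ * γ + γ * (2 * suc d * m * φ + 2 * φ)       ≤⟨ ℕ.+-mono-≤ (len-bound d φ)
                                                             (ℕ.*-monoʳ-≤ γ (ℕ.+-monoˡ-≤ (2 * φ) (len-bound (suc d) m))) ⟩
  len d φ + γ * (len (suc d) m + 2 * φ)                 ∎
  where
  open ℕ.≤-Reasoning
  φ = blocks (suc d) m
  γ = blocks d φ
  arith : ∀ d m φ γ → 2 * suc d * suc m * (γ * φ) ≡ 2 * d * φ * γ + γ * (2 * suc d * m * φ + 2 * φ)
  arith = solve-∀

mutual
  blocks≥1 : ∀ d m → 1 ≤ blocks d m
  blocks≥1 zero    m       = s≤s z≤n
  blocks≥1 (suc d) zero    = ℕ.≤-refl
  blocks≥1 (suc d) (suc m) = ℕ.≤-trans (s≤s z≤n) (blocks≥2 (suc d) (s≤s (z≤n {m})))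

  blocks≥2 : ∀ d {m} → 1 ≤ m → 2 ≤ blocks d m
  blocks≥2 zero    {suc m} _ = s≤s (s≤s z≤n)
  blocks≥2 (suc d) {suc m} _ =
    ℕ.*-mono-≤ (blocks≥2 d (blocks≥1 (suc d) m)) (blocks≥1 (suc d) m)

-- Bounds the excess of symbols per block over `m`. It does not depend on `m`, so it becomes
-- negligible once `m` is large compared with it.
slack : ℕ → ℕ
slack zero    = 2
slack (suc d) = 2 + 2 * slack d

slack-closed : ∀ d → slack d + 2 ≡ 4 * 2 ^ d
slack-closed zero    = refl
slack-closed (suc d) = trans (arith₁ (slack d)) (trans (cong (2 *_) (slack-closed d)) (arith₂ (2 ^ d)))
  where
  arith₁ : ∀ κ → 2 + 2 * κ + 2 ≡ 2 * (κ + 2)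
  arith₁ = solve-∀
  arith₂ : ∀ p → 2 * (4 * p) ≡ 4 * (2 * p)
  arith₂ = solve-∀

mutual
  size-bound : ∀ d m → size d m ≤ (m + slack d) * blocks d m
  size-bound zero    m = ℕ.≤-trans (ℕ.m≤m+n _ 1) (ℕ.≤-reflexive (arith m))
    where
    arith : ∀ m → (3 + m) * suc m + 1 ≡ (m + 2) * (2 + m)
    arith = solve-∀
  size-bound (suc d) m = ℕ.≤-trans (ℕ.m≤m+n _ (2 * slack d)) (size-bound′ d m)

  -- The extra summand makes the induction on m go through, since every step at
  -- least doubles the number of blocks.
  size-bound′ : ∀ d m → size (suc d) m + 2 * slack d ≤ (m + slack (suc d)) * blocks (suc d) m
  size-bound′ d zero    = ℕ.≤-reflexive (sym (ℕ.*-identityʳ _))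
  size-bound′ d (suc m) = begin
    size d φ + γ * σ + 2 * κ          ≤⟨ ℕ.+-mono-≤ (ℕ.+-monoˡ-≤ (γ * σ) (size-bound d φ))
                                            (ℕ.*-monoˡ-≤ κ (blocks≥2 d (blocks≥1 (suc d) m))) ⟩
    (φ + κ) * γ + γ * σ + γ * κ       ≡⟨ arith₁ φ κ γ σ ⟩
    γ * φ + γ * (σ + 2 * κ)           ≤⟨ ℕ.+-monoʳ-≤ (γ * φ) (ℕ.*-monoʳ-≤ γ (size-bound′ d m)) ⟩
    γ * φ + γ * ((m + (2 + 2 * κ)) * φ) ≡⟨ arith₂ φ κ γ m ⟩
    (suc m + (2 + 2 * κ)) * (γ * φ)   ∎
    where
    open ℕ.≤-Reasoning
    φ = blocks (suc d) m
    γ = blocks d φ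
    σ = size (suc d) m
    κ = slack d
    arith₁ : ∀ φ κ γ σ → (φ + κ) * γ + γ * σ + γ * κ ≡ γ * φ + γ * (σ + 2 * κ)
    arith₁ = solve-∀
    arith₂ : ∀ φ κ γ m → γ * φ + γ * ((m + (2 + 2 * κ)) * φ) ≡ (suc m + (2 + 2 * κ)) * (γ * φ)
    arith₂ = solve-∀

-- The Ackermann hierarchy that `αh` inverts

iter₁ : (ℕ → ℕ) → ℕ → ℕ
iter₁ h zero    = 1
iter₁ h (suc w) = h (iter₁ h w)

-- Level 0 is the power 2 ^ w and level 1 the tower function. Level `i` belongs to `αh (2 + i)`,
-- since iterated halving is already the logarithm.
ack : ℕ → ℕ → ℕ
ack zero    = iter₁ (2 *_)
ack (suc i) = iter₁ (ack i)

-- Each unit in the value of `iterA` is one application of `h`, which the hypothesis undoes by one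
-- application of `G`. The start 1 fits because a positive value requires an argument of at least 2.
iterA-inverse : ∀ {h G} → (∀ x w → w < h x → G w < x) →
  ∀ fuel x w → w < iterA h fuel x → iter₁ G w < x
iterA-inverse inv (suc fuel) (suc (suc x)) zero    _       = s≤s (s≤s z≤n)
iterA-inverse inv (suc fuel) (suc (suc x)) (suc w) (s≤s p) = inv _ _ (iterA-inverse inv fuel _ w p)

half-inverse : ∀ x w → w < ⌈ x /2⌉ → 2 * w < x
half-inverse (suc zero)    zero    _       = s≤s z≤n
half-inverse (suc zero)    (suc w) (s≤s ())
half-inverse (suc (suc x)) zero    _       = s≤s z≤n
half-inverse (suc (suc x)) (suc w) (s≤s p) =
  subst (_< 2 + x) (sym (ℕ.*-suc 2 w)) (s≤s (s≤s (half-inverse x w p)))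

αh-inverse : ∀ i x w → w < αh (2 + i) x → ack i w < x
αh-inverse zero    x = iterA-inverse half-inverse x x
αh-inverse (suc i) x = iterA-inverse (αh-inverse i) x x

ack-1 : ∀ i → ack i 1 ≡ 2
ack-1 zero    = refl
ack-1 (suc i) = ack-1 i

ack-2 : ∀ i → ack i 2 ≡ 4
ack-2 zero    = refl
ack-2 (suc i) = trans (cong (ack i) (ack-1 (suc i))) (ack-2 i)

-- All levels take 2 to 4, so the 3 in the definition of α becomes a 4 one level below.
ack-3 : ∀ i → ack (suc i) 3 ≡ ack i 4
ack-3 i = cong (ack i) (ack-2 (suc i))

mutual
  -- A step on level i + 1 applies level i, so doubling there is the linear bound of level i, which
  -- in turn rests on doubling on level i.
  ack-double : ∀ i w → 2 * ack i w ≤ ack i (suc w)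
  ack-double zero    w = ℕ.≤-refl
  ack-double (suc i) w = ack-linear i (ack (suc i) w) (ack-positive (suc i) w)

  ack-linear : ∀ i y → 1 ≤ y → 2 * y ≤ ack i y
  ack-linear i (suc zero)    _ = ℕ.≤-reflexive (sym (ack-1 i))
  ack-linear i (suc (suc y)) _ = begin
    2 * (2 + y)         ≤⟨ ℕ.*-monoʳ-≤ 2 (ℕ.+-monoʳ-≤ 2 (ℕ.m≤n*m y 2)) ⟩
    2 * (2 + 2 * y)     ≡⟨ cong (2 *_) (ℕ.*-suc 2 y) ⟨
    2 * (2 * suc y)     ≤⟨ ℕ.*-monoʳ-≤ 2 (ack-linear i (suc y) (s≤s z≤n)) ⟩
    2 * ack i (suc y)   ≤⟨ ack-double i (suc y) ⟩
    ack i (2 + y)       ∎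
    where open ℕ.≤-Reasoning

  ack-positive : ∀ i w → 1 ≤ ack i w
  ack-positive zero    zero    = ℕ.≤-refl
  ack-positive (suc i) zero    = ℕ.≤-refl
  ack-positive zero    (suc w) = ℕ.≤-trans (ack-positive zero w) (ℕ.m≤n*m _ 2)
  ack-positive (suc i) (suc w) = ack-positive i (ack (suc i) w)

-- Used to absorb factors: a factor 2 ^ t costs only t in the argument.
ack-shift : ∀ i t w → 2 ^ t * ack i w ≤ ack i (t + w)
ack-shift i zero    w = ℕ.≤-reflexive (ℕ.*-identityˡ _)
ack-shift i (suc t) w = begin
  2 * 2 ^ t * ack i w     ≡⟨ ℕ.*-assoc 2 (2 ^ t) (ack i w) ⟩
  2 * (2 ^ t * ack i w)   ≤⟨ ℕ.*-monoʳ-≤ 2 (ack-shift i t w) ⟩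
  2 * ack i (t + w)       ≤⟨ ack-double i (t + w) ⟩
  ack i (suc t + w)       ∎
  where open ℕ.≤-Reasoning

ack-mono : ∀ i {v w} → v ≤ w → ack i v ≤ ack i w
ack-mono i {v} {w} v≤w = begin
  ack i v                       ≤⟨ ℕ.m≤n*m (ack i v) (2 ^ (w ∸ v)) {{ℕ.m^n≢0 2 (w ∸ v)}} ⟩
  2 ^ (w ∸ v) * ack i v         ≤⟨ ack-shift i (w ∸ v) v ⟩
  ack i (w ∸ v + v)             ≡⟨ cong (ack i) (ℕ.m∸n+n≡m v≤w) ⟩
  ack i w                       ∎
  where open ℕ.≤-Reasoning

-- The bound is 16 times 4 ^ i, enough to dominate `width`. One level up the value at 4 is
-- `ack i (ack i 4)`, whose inner value is at least 8, and two doublings beyond 4 already give the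
-- required factor 4.
ack-4 : ∀ i → 16 * (2 ^ i * 2 ^ i) ≤ ack i 4
ack-4 zero    = ℕ.≤-refl
ack-4 (suc i) = begin
  16 * (2 * 2 ^ i * (2 * 2 ^ i))   ≡⟨ arith (2 ^ i) ⟩
  4 * (16 * (2 ^ i * 2 ^ i))       ≤⟨ ℕ.*-monoʳ-≤ 4 (ack-4 i) ⟩
  4 * ack i 4           ≤⟨ ack-shift i 2 4 ⟩
  ack i 6               ≤⟨ ack-mono i (ℕ.≤-trans (ℕ.m≤m+n 6 2) (ack-linear i 4 (s≤s z≤n))) ⟩
  ack i (ack i 4)       ≡⟨ cong (ack i) (ack-3 i) ⟨
  ack (suc i) 4         ∎
  where
  open ℕ.≤-Reasoning
  arith : ∀ p → 16 * (2 * p * (2 * p)) ≡ 4 * (16 * (p * p))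
  arith = solve-∀

n≤2^n : ∀ n → n ≤ 2 ^ n
n≤2^n zero    = z≤n
n≤2^n (suc n) = ℕ.+-mono-≤ (ℕ.m^n>0 2 n) (ℕ.≤-trans (n≤2^n n) (ℕ.m≤m+n _ 0))

-- The 2 and the 4 make the induction close: the factor φ is at most 2 ^ φ and shifts the argument 4
-- + φ to 2 φ + 4, which is just what the hypothesis for `m` bounds.
blocks-ack : ∀ d m → 2 * blocks d m + 4 ≤ ack (suc d) (4 + m)
blocks-ack zero m = ℕ.≤-trans (ℕ.≤-reflexive (arith m)) (ack-linear 1 (4 + m) (s≤s z≤n))
  where
  arith : ∀ m → 2 * (2 + m) + 4 ≡ 2 * (4 + m)
  arith = solve-∀
blocks-ack (suc d) zero = ℕ.≤-trans (ℕ.m≤m+n 6 2) (ack-linear (2 + d) 4 (s≤s z≤n))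
blocks-ack (suc d) (suc m) = begin
  2 * (γ * φ) + 4                     ≤⟨ ℕ.+-monoʳ-≤ (2 * (γ * φ)) (ℕ.*-monoʳ-≤ 4 (blocks≥1 (suc d) m)) ⟩
  2 * (γ * φ) + 4 * φ                 ≡⟨ arith₁ γ φ ⟩
  φ * (2 * γ + 4)                     ≤⟨ ℕ.*-mono-≤ (n≤2^n φ) (blocks-ack d φ) ⟩
  2 ^ φ * ack (suc d) (4 + φ)         ≤⟨ ack-shift (suc d) φ (4 + φ) ⟩
  ack (suc d) (φ + (4 + φ))           ≡⟨ cong (ack (suc d)) (arith₂ φ) ⟩
  ack (suc d) (2 * φ + 4)             ≤⟨ ack-mono (suc d) (blocks-ack (suc d) m) ⟩
  ack (suc d) (ack (2 + d) (4 + m))   ∎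
  where
  open ℕ.≤-Reasoning
  φ = blocks (suc d) m
  γ = blocks d φ
  arith₁ : ∀ γ φ → 2 * (γ * φ) + 4 * φ ≡ φ * (2 * γ + 4)
  arith₁ = solve-∀
  arith₂ : ∀ φ → φ + (4 + φ) ≡ 2 * φ + 4
  arith₂ = solve-∀

-- The `m` chosen for given `d`, equal to 6 times 4 ^ d: large enough for `slack-width`, small
-- enough for `threshold`.
width : ℕ → ℕ
width d = 6 * (2 ^ d * 2 ^ d)

-- Keeps the loss linear: the `slack d + 4` surplus symbols per block, charged d each, cost at most
-- `width d` per block.
slack-width : ∀ d → d * (slack d + 4) ≤ width d
slack-width d = begin
  d * (slack d + 4)           ≡⟨ cong (d *_) (trans (sym (ℕ.+-assoc (slack d) 2 2)) (cong (_+ 2) (slack-closed d))) ⟩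
  d * (4 * 2 ^ d + 2)         ≤⟨ ℕ.*-mono-≤ (n≤2^n d) (ℕ.+-monoʳ-≤ (4 * 2 ^ d) (ℕ.*-monoʳ-≤ 2 (ℕ.m^n>0 2 d))) ⟩
  2 ^ d * (4 * 2 ^ d + 2 * 2 ^ d)   ≡⟨ arith (2 ^ d) ⟩
  6 * (2 ^ d * 2 ^ d)         ∎
  where
  open ℕ.≤-Reasoning
  arith : ∀ p → p * (4 * p + 2 * p) ≡ 6 * (p * p)
  arith = solve-∀

2^n*2^n≥1 : ∀ n → 1 ≤ 2 ^ n * 2 ^ n
2^n*2^n≥1 n = ℕ.*-mono-≤ (ℕ.m^n>0 2 n) (ℕ.m^n>0 2 n)

-- The left side is the least n for which the large case is set up; the right side is what the
-- minimality of k puts below n.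
threshold : ∀ d → let μ = width d in 2 * μ * μ * blocks d μ ≤ ack (suc d) (ack (suc d) 4)
threshold d = begin
  2 * μ * μ * β                         ≡⟨ arith₁ μ β ⟩
  μ * μ * (2 * β)                       ≤⟨ ℕ.*-mono-≤ (ℕ.*-mono-≤ (n≤2^n μ) (n≤2^n μ))
                                             (ℕ.≤-trans (ℕ.m≤m+n (2 * β) 4) (blocks-ack d μ)) ⟩
  2 ^ μ * 2 ^ μ * ack (suc d) (4 + μ)   ≡⟨ cong (_* ack (suc d) (4 + μ)) (ℕ.^-distribˡ-+-* 2 μ μ) ⟨
  2 ^ (μ + μ) * ack (suc d) (4 + μ)     ≤⟨ ack-shift (suc d) (μ + μ) (4 + μ) ⟩
  ack (suc d) (μ + μ + (4 + μ))         ≤⟨ ack-mono (suc d) enough ⟩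
  ack (suc d) (ack (suc d) 4)           ∎
  where
  open ℕ.≤-Reasoning
  μ = width d
  β = blocks d μ
  p = 2 ^ d * 2 ^ d
  arith₁ : ∀ μ β → 2 * μ * μ * β ≡ μ * μ * (2 * β)
  arith₁ = solve-∀
  arith₂ : ∀ p → 6 * p + 6 * p + (4 + 6 * p) ≡ 18 * p + 4
  arith₂ = solve-∀
  arith₃ : ∀ p → 18 * p + 46 * p ≡ 64 * p
  arith₃ = solve-∀
  arith₄ : ∀ q → 64 * (q * q) ≡ 16 * (2 * q * (2 * q))
  arith₄ = solve-∀
  enough : μ + μ + (4 + μ) ≤ ack (suc d) 4
  enough = begin
    μ + μ + (4 + μ)               ≡⟨ arith₂ p ⟩
    -- The 46 completes 18 to 64, the coefficient in `ack-4 (suc d)` written in terms of p.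
    18 * p + 4                    ≤⟨ ℕ.+-monoʳ-≤ (18 * p) (ℕ.*-mono-≤ (ℕ.m≤m+n 4 42) (2^n*2^n≥1 d)) ⟩
    18 * p + 46 * p               ≡⟨ arith₃ p ⟩
    64 * p                        ≡⟨ arith₄ (2 ^ d) ⟩
    16 * (2 ^ suc d * 2 ^ suc d)  ≤⟨ ack-4 (suc d) ⟩
    ack (suc d) 4                 ∎

-- Sequences for every n

module _ (d n : ℕ) (large : 2 * width d * width d * blocks d (width d) ≤ n) where

  private
    μ = width d
    β = blocks d μ
    κ = slack d
    -- Each of the q = n / S copies uses at most S symbols. The symbols left over are
    -- fewer than S ≤ n / (d + 1), so they cost only O(n).
    S = (μ + κ + 4) * β

    open ℕ.≤-Reasoning

    β≥1 : 1 ≤ β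
    β≥1 = blocks≥1 d μ

    slack-small : κ + 4 ≤ μ
    slack-small = begin
      κ + 4                 ≡⟨ trans (sym (ℕ.+-assoc κ 2 2)) (cong (_+ 2) (slack-closed d)) ⟩
      4 * 2 ^ d + 2         ≤⟨ ℕ.+-mono-≤ (ℕ.*-monoʳ-≤ 4 (ℕ.m≤m*n (2 ^ d) (2 ^ d) {{ℕ.m^n≢0 2 d}}))
                                 (ℕ.*-monoʳ-≤ 2 (2^n*2^n≥1 d)) ⟩
      4 * (2 ^ d * 2 ^ d) + 2 * (2 ^ d * 2 ^ d)   ≡⟨ ℕ.*-distribʳ-+ (2 ^ d * 2 ^ d) 4 2 ⟨
      μ                     ∎

    d<μ : suc d ≤ μ
    d<μ = begin
      suc d                   ≤⟨ n≤2^n (suc d) ⟩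
      2 * 2 ^ d               ≤⟨ ℕ.*-mono-≤ (ℕ.m≤m+n 2 4) (ℕ.m≤m*n (2 ^ d) (2 ^ d) {{ℕ.m^n≢0 2 d}}) ⟩
      μ                       ∎

    dS≤n : suc d * S ≤ n
    dS≤n = begin
      suc d * ((μ + κ + 4) * β)   ≤⟨ ℕ.*-mono-≤ d<μ (ℕ.*-monoˡ-≤ β
                                       (ℕ.≤-trans (ℕ.≤-reflexive (ℕ.+-assoc μ κ 4)) (ℕ.+-monoʳ-≤ μ slack-small))) ⟩
      μ * ((μ + μ) * β)           ≡⟨ arith μ β ⟩
      2 * μ * μ * β               ≤⟨ large ⟩
      n                           ∎
      where
      arith : ∀ μ β → μ * ((μ + μ) * β) ≡ 2 * μ * μ * β
      arith = solve-∀

    S≤n : S ≤ n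
    S≤n = ℕ.≤-trans (ℕ.m≤m+n S (d * S)) dS≤n

    S≥1 : 1 ≤ S
    S≥1 = ℕ.*-mono-≤ (ℕ.≤-trans (s≤s z≤n) (ℕ.m≤n+m 4 (μ + κ))) β≥1

    instance
      S-nonZero : NonZero S
      S-nonZero = >-nonZero S≥1

    q = n / S

    q≥1 : 1 ≤ q
    q≥1 = ℕ.m≥n⇒m/n>0 S≤n

    qS≤n : q * S ≤ n
    qS≤n = ℕ.m/n*n≤m n S

    n≤qS+S : n ≤ q * S + S
    n≤qS+S = begin
      n                   ≡⟨ ℕ.m≡m%n+[m/n]*n n S ⟩
      n % S + q * S       ≤⟨ ℕ.+-monoˡ-≤ (q * S) (ℕ.<⇒≤ (ℕ.m%n<n n S)) ⟩
      S + q * S           ≡⟨ ℕ.+-comm S (q * S) ⟩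
      q * S + S           ∎

    -- The connecting chain has q + 1 rows of β + 1 symbols, at most 4 q β in all; this is the 4 in
    -- `S`.
    fits : suc q * suc β + q * size d μ ≤ n
    fits = begin
      suc q * suc β + q * size d μ              ≤⟨ ℕ.+-mono-≤ (ℕ.*-mono-≤ (ℕ.+-monoˡ-≤ q q≥1) (ℕ.+-monoˡ-≤ β β≥1))
                                                     (ℕ.*-monoʳ-≤ q (size-bound d μ)) ⟩
      (q + q) * (β + β) + q * ((μ + κ) * β)     ≡⟨ arith q β μ κ ⟩
      q * S                                     ≤⟨ qS≤n ⟩
      n                                         ∎
      where
      arith : ∀ q β μ κ → (q + q) * (β + β) + q * ((μ + κ) * β) ≡ q * ((μ + κ + 4) * β)
      arith = solve-∀

    -- The 16 is 12 + 2 + 2: 12 n because k exceeds d by 6, 2 n for the surplus symbols in the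
    -- copies, and 2 n for the fewer than `S` symbols left over.
    long-enough : 2 * n * (6 + d) ≤ q * (len d μ + 2 * β) + 16 * n
    long-enough = begin
      2 * n * (6 + d)                                      ≡⟨ arith₁ n d ⟩
      2 * d * n + 12 * n                                   ≤⟨ ℕ.+-monoˡ-≤ (12 * n) (ℕ.*-monoʳ-≤ (2 * d) n≤qS+S) ⟩
      2 * d * (q * S + S) + 12 * n                         ≡⟨ arith₂ d q μ κ β n ⟩
      q * (2 * d * μ * β) + 2 * (q * (d * (κ + 4) * β)) + 2 * (d * S) + 12 * n
        ≤⟨ ℕ.+-monoˡ-≤ (12 * n) (ℕ.+-mono-≤ (ℕ.+-mono-≤
             (ℕ.*-monoʳ-≤ q (ℕ.≤-trans (len-bound d μ) (ℕ.m≤m+n _ (2 * β))))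
             (ℕ.*-monoʳ-≤ 2 (ℕ.≤-trans (ℕ.*-monoʳ-≤ q (ℕ.*-monoˡ-≤ β
               (ℕ.≤-trans (slack-width d) (ℕ.≤-trans (ℕ.m≤m+n μ κ) (ℕ.m≤m+n (μ + κ) 4))))) qS≤n)))
             (ℕ.*-monoʳ-≤ 2 (ℕ.≤-trans (ℕ.m≤n+m (d * S) S) dS≤n))) ⟩
      q * (len d μ + 2 * β) + 2 * n + 2 * n + 12 * n       ≡⟨ arith₃ (q * (len d μ + 2 * β)) n ⟩
      q * (len d μ + 2 * β) + 16 * n                       ∎
      where
      arith₁ : ∀ n d → 2 * n * (6 + d) ≡ 2 * d * n + 12 * n
      arith₁ = solve-∀
      arith₂ : ∀ d q μ κ β n → 2 * d * (q * ((μ + κ + 4) * β) + (μ + κ + 4) * β) + 12 * n ≡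
        q * (2 * d * μ * β) + 2 * (q * (d * (κ + 4) * β)) + 2 * (d * ((μ + κ + 4) * β)) + 12 * n
      arith₂ = solve-∀
      arith₃ : ∀ ℓ n → ℓ + 2 * n + 2 * n + 12 * n ≡ ℓ + 16 * n
      arith₃ = solve-∀

  large-case : Σ (List (Fin n)) λ w → DS 3 w × 2 * n * (6 + d) ≤ length w + 16 * n
  large-case =
    -- Expanding a chain with q blocks of width β strings q copies of `fan d μ` together.
    let w , ds , q*len≤ = fan⇒DS (expand-fan (fan d μ) (chain-fan q β)) fits
    in w , ds , ℕ.≤-trans long-enough (ℕ.+-monoˡ-≤ (16 * n) q*len≤)

-- The error term alone covers 2 n k, so the empty sequence will do.
small-case : ∀ n {k} → k ≤ 8 → Σ (List (Fin n)) λ w → DS 3 w × 2 * n * k ≤ length w + 16 * n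
small-case n {k} k≤8 = [] , ([] , λ _ _ _ ()) , (begin
  2 * n * k   ≤⟨ ℕ.*-monoʳ-≤ (2 * n) k≤8 ⟩
  2 * n * 8   ≡⟨ arith n ⟩
  16 * n      ∎)
  where
  open ℕ.≤-Reasoning
  arith : ∀ n → 2 * n * 8 ≡ 16 * n
  arith = solve-∀

theorem1p6 : Σ ℕ λ C → (n k : ℕ) → IsInvAck n k →
    Σ (List (Fin n)) λ w → DS 3 w × 2 * n * k ≤ length w + C * n
theorem1p6 = 16 , bound
  where
  bound : (n k : ℕ) → IsInvAck n k →
    Σ (List (Fin n)) λ w → DS 3 w × 2 * n * k ≤ length w + 16 * n
  bound n k (_ , _ , minimal) with ℕ.<-≤-connex k 6
  ... | inj₁ k<6 = small-case n (ℕ.≤-trans (ℕ.<⇒≤ k<6) (ℕ.m≤m+n 6 2))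
  ... | inj₂ 6≤k with ℕ.m≤n⇒∃[o]m+o≡n 6≤k
  ...   | d , refl = large-case d n (begin
    2 * μ * μ * blocks d μ               ≤⟨ threshold d ⟩
    ack (suc d) (ack (suc d) 4)          ≡⟨ cong (ack (suc d)) (ack-3 (suc d)) ⟨
    ack (2 + d) 4                        ≡⟨ ack-3 (2 + d) ⟨
    -- As k = 6 + d is minimal, `αh (5 + d) n` exceeds 3, and level 5 + d of `αh` is inverse to
    -- level 3 + d of `ack`.
    ack (3 + d) 3                        <⟨ αh-inverse (3 + d) n 3 (ℕ.≰⇒> (minimal (5 + d) (s≤s z≤n) ℕ.≤-refl)) ⟩
    n                                    ∎)
    where
    open ℕ.≤-Reasoning
    μ = width d
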